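{- Let $\alpha\in(0,1/2)$ and let $f$ be a fixed function from positive integers to positive integers, given before the construction of the data structure, such that $f(x)\le f(x+1)\le f(x)+1$ and $1\le f(x)\le x$ for all $x$. There exists an $O(n/\alpha^2)$-bit data structure that, for a sequence of $n$ elements, supports one-dimensional $\alpha$-approximate fixed-rank $f(b-a+1)=k$ selection queries in constant time.
   Context: Let $c_1,\dots,c_n$ be a sequence of elements from a totally ordered set; write $c_{a..b}$ for $c_a,\dots,c_b$. The $i$th smallest element in $c_{a..b}$ (counted with multiplicity) is said to have rank $i$ in $c_{a..b}$. An $\alpha$-approximate fixed-rank $f(b-a+1)=k$ selection query is given indices $1\le a\le b\le n$ and asks for the position (an index in $[a,b]$) of an element whose rank in $c_{a..b}$ is between $k-\alpha s$ and $k+\alpha s$, where $s=b-a+1$ and $k=f(s)$. (For example, $f(s)=\lceil s/2\rceil$ is the range median problem.) The sequence is static and is preprocessed into a data structure. Queries are answered from the data structure alone, without access to the original sequence (encoding model), and the stated space counts everything stored. The model of computation is the word RAM with words of $\Theta(\lg n)$ bits. Constants hidden in $O(\cdot)$ are absolute. -}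

module Defs where

open import Data.Bool.Base using (Bool; true; false; not; _∧_; _∨_; _xor_; if_then_else_)
open import Data.Fin.Base as Fin using (Fin; toℕ; inject≤)
open import Data.Integer.Base using (+_)
open import Data.List.Base using (List; take; drop; head; length; lookup)
open import Data.List.Relation.Binary.Permutation.Propositional using (_↭_)
import Data.List.Relation.Unary.Sorted.TotalOrder as Sorting
open import Data.Maybe.Base using (Maybe; just; nothing)
open import Data.Nat.Base hiding (_⊔_)
open import Data.Nat.DivMod using (_mod_)
open import Data.Nat.Logarithm using (⌊log₂_⌋)
open import Data.Nat.Properties using (m^n≢0)
open import Data.Product.Base using (Σ; ∃-syntax; _×_)
open import Data.Rational.Base as ℚ using (ℚ; 0ℚ)
open import Data.Sum.Base using (_⊎_)
open import Data.Vec.Base as Vec using (Vec; toList)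
open import Function.Bundles using (_⇔_)
open import Level using (_⊔_)
open import Relation.Binary.Bundles using (TotalOrder)
open import Relation.Binary.PropositionalEquality.Core using (_≡_)
open import Relation.Nullary.Negation.Core using (¬_)

-- Two-sided located Dedekind cuts.
record ℝ : Set₁ where
  field
    _<-below : ℚ → Set   -- q <-below  means  q < α
    _>-above : ℚ → Set   -- q >-above  means  α < q
    below-inhabited : ∃[ q ] q <-below
    above-inhabited : ∃[ q ] q >-above
    below-rounded   : ∀ q → q <-below ⇔ (∃[ r ] q ℚ.< r × r <-below)
    above-rounded   : ∀ q → q >-above ⇔ (∃[ r ] r ℚ.< q × r >-above)
    disjoint        : ∀ q → ¬ (q <-below × q >-above)
    located         : ∀ q r → q ℚ.< r → q <-below ⊎ r >-above

infix 4 _<ℝ_ _ℝ<_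

_<ℝ_ : ℚ → ℝ → Set
q <ℝ α = ℝ._<-below α q

_ℝ<_ : ℝ → ℚ → Set
α ℝ< q = ℝ._>-above α q

fromℕ : ℕ → ℚ
fromℕ n = + n ℚ./ 1

-- k − α s ≤ i ≤ k + α s.  A weak inequality that is monotone in α holds
-- at α iff it holds at every rational above α.
ApproxRank : ℝ → (k s i : ℕ) → Set
ApproxRank α k s i = ∀ q → α ℝ< q →
    fromℕ k ℚ.- q ℚ.* fromℕ s ℚ.≤ fromℕ i
  × fromℕ i ℚ.≤ fromℕ k ℚ.+ q ℚ.* fromℕ s

-- bits ≤ C n / α² for α > 0, i.e. bits · α² ≤ C n, tested at the positive
-- rationals below α.
SpaceBound : (C n : ℕ) → ℝ → (bits : ℕ) → Set
SpaceBound C n α bits = ∀ q → 0ℚ ℚ.< q → q <ℝ α →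
  fromℕ bits ℚ.* (q ℚ.* q) ℚ.≤ fromℕ (C * n)

-- The number of bits of n (for n ≥ 1); it is Θ(lg n) and positive at n = 1.
lg : ℕ → ℕ
lg n = suc ⌊log₂ n ⌋

Word : ℕ → Set
Word w = Fin (2 ^ w)

wrap : ∀ w → ℕ → Word w
wrap w x = _mod_ x (2 ^ w) {{m^n≢0 2 w}}

fromBool : Bool → ℕ
fromBool b = if b then 1 else 0

odd : ℕ → Bool
odd zero    = false
odd (suc n) = not (odd n)

-- Applies g to the w low-order binary digits of x and y.
bitwise : (Bool → Bool → Bool) → (w x y : ℕ) → ℕ
bitwise g zero    x y = 0
bitwise g (suc w) x y =
  fromBool (g (odd x) (odd y)) + 2 * bitwise g w ⌊ x /2⌋ ⌊ y /2⌋

data Op : Set where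
  add sub mul div mod and or xor shl shr lt eq : Op

-- Results are reduced modulo 2 ^ w; division and remainder by 0 give 0.
eval : Op → (w x y : ℕ) → ℕ
eval add w x y       = x + y
eval sub w x y       = x + 2 ^ w ∸ y
eval mul w x y       = x * y
eval div w x zero    = 0
eval div w x (suc y) = x / suc y
eval mod w x zero    = 0
eval mod w x (suc y) = x % suc y
eval and w x y       = bitwise _∧_ w x y
eval or  w x y       = bitwise _∨_ w x y
eval xor w x y       = bitwise _xor_ w x y
eval shl w x y       = x * 2 ^ y
eval shr w x y       = _/_ x (2 ^ y) {{m^n≢0 2 y}}
eval lt  w x y       = fromBool (x <ᵇ y)
eval eq  w x y       = fromBool (x ≡ᵇ y)

-- Registers are named by constants, so a program uses only finitely many.
Reg : Set
Reg = ℕ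

data Instr : Set where
  const : (r : Reg) (x : ℕ) → Instr        -- r ← x
  op    : Op → (r s t : Reg) → Instr       -- r ← s ∘ t
  load  : (r s : Reg) → Instr              -- r ← mem[s]
  store : (r s : Reg) → Instr              -- mem[s] ← r
  jz    : (r : Reg) (target : ℕ) → Instr   -- if r = 0 go to target

Program : Set
Program = List Instr

record State (w : ℕ) : Set where
  constructor state
  field
    pc   : ℕ
    regs : Reg → Word w
    mem  : Word w → Word w

_[_≔_] : ∀ {A : Set} → (ℕ → A) → ℕ → A → (ℕ → A)
(g [ r ≔ x ]) r′ = if r ≡ᵇ r′ then x else g r′

exec : ∀ {w} → Instr → State w → State w
exec {w} (const r x) (state pc regs mem) =
  state (suc pc) (regs [ r ≔ wrap w x ]) mem
exec {w} (op o r s t) (state pc regs mem) =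
  state (suc pc) (regs [ r ≔ wrap w (eval o w (toℕ (regs s)) (toℕ (regs t))) ]) mem
exec (load r s) (state pc regs mem) =
  state (suc pc) (regs [ r ≔ mem (regs s) ]) mem
exec (store r s) (state pc regs mem) =
  state (suc pc) regs
    (λ i → if toℕ (regs s) ≡ᵇ toℕ i then regs r else mem i)
exec (jz r target) (state pc regs mem) =
  state (if toℕ (regs r) ≡ᵇ 0 then target else suc pc) regs mem

-- The machine halts when pc leaves the program; the result is nothing if
-- it has not halted after t steps.
run : ∀ {w} → Program → (t : ℕ) → State w → Maybe (State w)
run P t σ with head (drop (State.pc σ) P)
run P t       σ | nothing = just σ
run P zero    σ | just _  = nothing
run P (suc t) σ | just i  = run P t (exec i σ)

-- A static structure: the words at addresses 0, …, size − 1.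
record DataStructure (w : ℕ) : Set where
  field
    size        : ℕ
    addressable : size ≤ 2 ^ w
    contents    : Vec (Word w) size

  bits : ℕ
  bits = size * w

StoredIn : ∀ {w} → DataStructure w → (Word w → Word w) → Set
StoredIn D mem = ∀ (i : Fin size) → mem (inject≤ i addressable) ≡ Vec.lookup contents i
  where open DataStructure D

queryRegs : ∀ w → (a b : ℕ) → Reg → Word w
queryRegs w a b 0 = wrap w a
queryRegs w a b 1 = wrap w b
queryRegs w a b _ = wrap w 0

-- Started on arguments a and b, P halts within T steps with output y (in
-- register 0).  Cells outside the structure are scratch space with arbitrary
-- initial contents; the structure itself must be intact afterwards, so that
-- it can serve further queries.
Computes : ∀ {w} → Program → (T : ℕ) → DataStructure w → (a b y : ℕ) → Set
Computes {w} P T D a b y = ∀ (mem : Word w → Word w) → StoredIn D mem →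
  Σ (State w) λ σ →
      run P T (state 0 (queryRegs w a b) mem) ≡ just σ
    × toℕ (State.regs σ 0) ≡ y
    × StoredIn D (State.mem σ)

-- The value f 0 plays no role.
record FixedRank (f : ℕ → ℕ) : Set where
  field
    monotone  : ∀ x → 1 ≤ x → f x ≤ f (suc x)
    increment : ∀ x → 1 ≤ x → f (suc x) ≤ f x + 1
    positive  : ∀ x → 1 ≤ x → 1 ≤ f x
    bounded   : ∀ x → 1 ≤ x → f x ≤ x

-- Positions are 0-based: c_{a..b} has the b − a + 1 entries at a, …, b.
rangeSize : ∀ {n} → (a b : Fin n) → ℕ
rangeSize a b = suc (toℕ b ∸ toℕ a)

range : ∀ {ℓ} {A : Set ℓ} {n} → Vec A n → (a b : Fin n) → List A
range c a b = take (rangeSize a b) (drop (toℕ a) (toList c))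

module _ {ℓ ℓ₁ ℓ₂} (O : TotalOrder ℓ ℓ₁ ℓ₂) where
  open TotalOrder O using (Carrier; _≈_)
  open Sorting O using (Sorted)

  -- x is the i-th smallest element of xs, counted with multiplicity; when xs
  -- has repeated elements, x has several ranks.
  HasRank : List Carrier → ℕ → Carrier → Set (ℓ ⊔ ℓ₁ ⊔ ℓ₂)
  HasRank xs i x = ∃[ ys ] ys ↭ xs × Sorted ys ×
    Σ (Fin (length ys)) λ j → i ≡ suc (toℕ j) × lookup ys j ≈ x

  IsApproxSelection : ∀ {n} → ℝ → (ℕ → ℕ) → Vec Carrier n →
                      (a b p : Fin n) → Set (ℓ ⊔ ℓ₁ ⊔ ℓ₂)
  IsApproxSelection α f c a b p = a Fin.≤ p × p Fin.≤ b ×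
    ∃[ i ] HasRank (range c a b) i (Vec.lookup c p)
         × ApproxRank α (f (rangeSize a b)) (rangeSize a b) i

  SupportsSelection : ∀ {n w} → Program → (T : ℕ) → ℝ → (ℕ → ℕ) →
                      Vec Carrier n → DataStructure w → Set (ℓ ⊔ ℓ₁ ⊔ ℓ₂)
  SupportsSelection {n} P T α f c D = ∀ (a b : Fin n) → a Fin.≤ b →
    ∃[ p ] IsApproxSelection α f c a b p × Computes P T D (toℕ a) (toℕ b) (toℕ p)

{-# OPTIONS --safe #-}
module Submission where

-- Take m = 2^e with 1 / m < α < 4 / m.  A query of size s is assigned a level i with 4^i ≤ s < 8 · 4^i, and its
-- endpoints are rounded inwards to multiples of g ≈ 4^i / 2m.  The remaining core misses at most s / m entries;
-- as f is monotone and 1-Lipschitz, the entry of rank f (length) in the core has rank within s / m of f (s) in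
-- the whole range.  Level i has O(n / g) core starts with O(m) lengths each, and an answer is an offset of O(i)
-- bits, so it needs O(n m² i / 4^i) bits.  This decays faster than the density 2^-(i+1) that array i receives
-- when the levels are interleaved at the addresses (2 q + 1) · 2^i, so no prefix sums of array sizes are needed.
-- The level is found in constant time from a table of O(√n) words, indexed by s or, if s is large, by the upper
-- half of s.

-- Levels by powers of 4: with powers of 2 the demand i / 2^i would exceed the density 2^-(i+1) by
-- the unbounded factor i, and the space bound would gain a logarithm. The program is fixed before n
-- and α, so whatever depends on them is read from memory, even the threshold of the level table; as
-- it has no jumps, it selects the half of that table arithmetically. A cut cannot be compared with
-- a single rational, so 1 / m approximates α only up to a factor 4, which costs a factor 16 in
-- space. α may be tiny compared with 1 / n, and then n m² cells could not be addressed with O(lg n)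
-- bits. The layout therefore uses the precision min (m, n + 1), which need not be a power of 2. All
-- ranges are filters of one sorted list of (position, value) pairs. Ties are thus broken alike in a
-- core and in the range around it, and comparing ranks reduces to counting.

open import Defs
open import Algebra.Bundles using (module CommutativeMonoid)
import Algebra.Properties.CommutativeSemigroup as CommutativeSemigroup
open import Data.Bool.Base using (true; false; if_then_else_; T)
open import Data.Bool.Properties using (not-involutive)
open import Data.Fin.Base as Fin using (Fin; toℕ; inject≤)
open import Data.Fin.Properties as Fin using (toℕ-cast; toℕ<n; toℕ-fromℕ<)
open import Data.Integer.Base as ℤ using ()
import Data.Integer.Properties as ℤ
open import Data.List.Base as List using (List; []; _∷_; map; filter; take; drop; length; lookup; head)
open import Data.List.Membership.Propositional.Properties using (∈-lookup)
open import Data.List.Properties using (length-map; length-take; length-drop; filter-accept; filter-reject)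
open import Data.List.Relation.Binary.Permutation.Propositional
  using (_↭_; ↭-refl; ↭-sym; ↭-trans; ↭-reflexive; prep; swap)
open import Data.List.Relation.Binary.Permutation.Propositional.Properties
  using (↭-length; filter-↭; All-resp-↭) renaming (map⁺ to map⁺-↭)
open import Data.List.Relation.Unary.All as All using (All; []; _∷_)
open import Data.List.Relation.Unary.All.Properties as All using (all-filter)
open import Data.List.Relation.Unary.Linked using (Linked; []; [-]; _∷_)
open import Data.List.Relation.Unary.Linked.Properties as Linked using ()
open import Data.Maybe.Base using (just; maybe′)
open import Data.Nat.Base
open import Data.Nat.Coprimality using (1-coprimeTo) renaming (sym to coprime-sym)
open import Data.Nat.Divisibility.Core using (divides-refl)
open import Data.Nat.DivMod hiding (_div_; _mod_)
open import Data.Nat.Induction using (<-rec)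
open import Data.Nat.Logarithm using (⌊log₂_⌋; ⌊log₂⌋-mono-≤; ⌊log₂[2^n]⌋≡n; ⌊log₂⌊n/2⌋⌋≡⌊log₂n⌋∸1)
open import Data.Nat.Properties
open import Data.Nat.Tactic.RingSolver using (solve-∀)
open import Data.Product.Base using (Σ; ∃-syntax; _×_; _,_; proj₁; proj₂; map₁)
open import Data.Rational.Base as ℚ using (ℚ; mkℚ; 0ℚ; 1ℚ; ½)
import Data.Rational.Properties as ℚ
import Data.Rational.Unnormalised.Base as ℚᵘ
import Data.Rational.Unnormalised.Properties as ℚᵘ
open import Data.Sum.Base using (inj₁; inj₂)
open import Data.Vec.Base as Vec using (Vec; []; _∷_; toList)
open import Data.Vec.Properties using (length-toList; lookup∘tabulate)
open import Function.Base using (_∘_; _on_; _$′_)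
open import Function.Bundles using (module Equivalence)
open import Level using () renaming (_⊔_ to _⊔ℓ_)
open import Relation.Binary.Bundles using (TotalOrder)
open import Relation.Binary.Core using (Rel)
open import Relation.Binary.Definitions using (Total)
open import Relation.Binary.PropositionalEquality
open import Relation.Nullary using (contradiction; yes; no)
open import Relation.Nullary.Decidable using (_×-dec_)
open import Relation.Unary using (Pred; Decidable; _⊆_)

-- Approximate ranks in subranges

module _ {a ℓ} {A : Set a} {_≼_ : Rel A ℓ} (total : Total _≼_) where

  insert : A → List A → List A
  insert x []       = x ∷ []
  insert x (y ∷ ys) with total x y
  ... | inj₁ _ = x ∷ y ∷ ys
  ... | inj₂ _ = y ∷ insert x ys

  insertionSort : List A → List A
  insertionSort []       = []
  insertionSort (x ∷ xs) = insert x (insertionSort xs)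

  insert-↭ : ∀ x ys → insert x ys ↭ x ∷ ys
  insert-↭ x []       = ↭-refl
  insert-↭ x (y ∷ ys) with total x y
  ... | inj₁ _ = ↭-refl
  ... | inj₂ _ = ↭-trans (prep y (insert-↭ x ys)) (swap y x ↭-refl)

  insertionSort-↭ : ∀ xs → insertionSort xs ↭ xs
  insertionSort-↭ []       = ↭-refl
  insertionSort-↭ (x ∷ xs) =
    ↭-trans (insert-↭ x (insertionSort xs)) (prep x (insertionSort-↭ xs))

  insert-linked : ∀ x {ys} → Linked _≼_ ys → Linked _≼_ (insert x ys)
  insert-linked-∷ : ∀ {x y} ys → y ≼ x → Linked _≼_ (y ∷ ys) → Linked _≼_ (y ∷ insert x ys)

  insert-linked x []  = [-]
  insert-linked x {y ∷ ys} ys↗ with total x y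
  ... | inj₁ x≼y = x≼y ∷ ys↗
  ... | inj₂ y≼x = insert-linked-∷ ys y≼x ys↗

  insert-linked-∷ []       y≼x _ = y≼x ∷ [-]
  insert-linked-∷ {x} (z ∷ zs) y≼x (y≼z ∷ zs↗) with total x z
  ... | inj₁ x≼z = y≼x ∷ x≼z ∷ zs↗
  ... | inj₂ z≼x = y≼z ∷ insert-linked-∷ zs z≼x zs↗

  insertionSort-linked : ∀ xs → Linked _≼_ (insertionSort xs)
  insertionSort-linked []       = []
  insertionSort-linked (x ∷ xs) = insert-linked x (insertionSort-linked xs)

module _ {a p q} {A : Set a} {P : Pred A p} {Q : Pred A q}
         (P? : Decidable P) (Q? : Decidable Q) (P⊆Q : P ⊆ Q) where

  length-filter-⊆ : ∀ xs → length (filter P? xs) ≤ length (filter Q? xs)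
  length-filter-⊆ []       = z≤n
  length-filter-⊆ (x ∷ xs) with P? x | Q? x
  ... | yes _  | yes _  = s≤s (length-filter-⊆ xs)
  ... | yes px | no ¬qx with () ← ¬qx (P⊆Q px)
  ... | no _   | yes _  = m≤n⇒m≤1+n (length-filter-⊆ xs)
  ... | no _   | no _   = length-filter-⊆ xs

  -- Whatever `P?` keeps before the entry is kept by `Q?` too, so the index cannot drop. It rises by
  -- the number of earlier entries kept by `Q?` alone, at most the difference of the two lengths.
  -- The additive form avoids truncated subtraction.
  lookup-filter-⊆ : ∀ xs (j : Fin (length (filter P? xs))) →
    Σ (Fin (length (filter Q? xs))) λ k →
      lookup (filter Q? xs) k ≡ lookup (filter P? xs) j
      × toℕ j ≤ toℕ k
      × toℕ k + length (filter P? xs) ≤ toℕ j + length (filter Q? xs)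
  lookup-filter-⊆ (x ∷ xs) j with P? x | Q? x
  lookup-filter-⊆ (x ∷ xs) Fin.zero    | yes _  | yes _ =
    Fin.zero , refl , z≤n , s≤s (length-filter-⊆ xs)
  lookup-filter-⊆ (x ∷ xs) (Fin.suc j) | yes _  | yes _
    with k , k≈j , j≤k , k≤j ← lookup-filter-⊆ xs j =
    Fin.suc k , k≈j , s≤s j≤k ,
    s≤s (subst₂ _≤_ (sym (+-suc (toℕ k) _)) (sym (+-suc (toℕ j) _)) (s≤s k≤j))
  lookup-filter-⊆ (x ∷ xs) j           | yes px | no ¬qx with () ← ¬qx (P⊆Q px)
  lookup-filter-⊆ (x ∷ xs) j           | no _   | yes _
    with k , k≈j , j≤k , k≤j ← lookup-filter-⊆ xs j =
    Fin.suc k , k≈j , m≤n⇒m≤1+n j≤k ,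
    ≤-trans (s≤s k≤j) (≤-reflexive (sym (+-suc (toℕ j) _)))
  lookup-filter-⊆ (x ∷ xs) j           | no _   | no _  = lookup-filter-⊆ xs j

lookup-map-cast : ∀ {a b} {A : Set a} {B : Set b} (g : A → B) xs (k : Fin (length xs)) →
  lookup (map g xs) (Fin.cast (sym (length-map g xs)) k) ≡ g (lookup xs k)
lookup-map-cast g (x ∷ xs) Fin.zero    = refl
lookup-map-cast g (x ∷ xs) (Fin.suc k) = lookup-map-cast g xs k

-- Positions attached to entries, and ranges as filters

module _ {a} {A : Set a} where

  enumerate : ℕ → List A → List (ℕ × A)
  enumerate o []       = []
  enumerate o (x ∷ xs) = (o , x) ∷ enumerate (suc o) xs

  Within : (lo hi : ℕ) → ℕ × A → Set
  Within lo hi (i , _) = lo ≤ i × i < hi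

  within? : ∀ lo hi → Decidable (Within lo hi)
  within? lo hi (i , _) = lo ≤? i ×-dec i <? hi

  filter-within-prefix : ∀ {lo} hi {o} xs → lo ≤ o →
    map proj₂ (filter (within? lo hi) (enumerate o xs)) ≡ take (hi ∸ o) xs
  filter-within-prefix hi {o} [] lo≤o with hi ∸ o
  ... | zero  = refl
  ... | suc _ = refl
  filter-within-prefix {lo} hi {o} (x ∷ xs) lo≤o with o <? hi
  ... | yes o<hi
    rewrite filter-accept (within? lo hi) {o , x} {enumerate (suc o) xs} (lo≤o , o<hi)
          | filter-within-prefix hi xs (m≤n⇒m≤1+n lo≤o)
          | +-∸-assoc 1 o<hi = refl
  ... | no o≮hi
    rewrite filter-reject (within? lo hi) {o , x} {enumerate (suc o) xs} (o≮hi ∘ proj₂)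
          | filter-within-prefix hi xs (m≤n⇒m≤1+n lo≤o)
          | m≤n⇒m∸n≡0 (≮⇒≥ o≮hi) | m≤n⇒m∸n≡0 (m≤n⇒m≤1+n (≮⇒≥ o≮hi)) = refl

  filter-within : ∀ {lo} hi {o} xs → o ≤ lo →
    map proj₂ (filter (within? lo hi) (enumerate o xs)) ≡ take (hi ∸ lo) (drop (lo ∸ o) xs)
  filter-within {lo} hi {o} xs o≤lo with m≤n⇒m<n∨m≡n o≤lo
  ... | inj₂ refl rewrite n∸n≡0 o = filter-within-prefix hi xs ≤-refl
  filter-within {lo} hi {o} [] o≤lo | inj₁ o<lo with hi ∸ lo | lo ∸ o
  ... | zero  | _     = refl
  ... | suc _ | zero  = refl
  ... | suc _ | suc _ = refl
  filter-within {lo} hi {o} (x ∷ xs) o≤lo | inj₁ o<lo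
    rewrite filter-reject (within? lo hi) {o , x} {enumerate (suc o) xs} (<⇒≱ o<lo ∘ proj₁)
          | filter-within hi xs o<lo
          | +-∸-assoc 1 o<lo = refl

  All-enumerate : ∀ {n} o (c : Vec A n) →
    All (λ (i , x) → ∃[ p ] i ≡ o + toℕ p × x ≡ Vec.lookup c p) (enumerate o (toList c))
  All-enumerate o []      = []
  All-enumerate o (x ∷ c) = (Fin.zero , sym (+-identityʳ o) , refl) ∷
    All.map (λ (p , i≡ , x≡) → Fin.suc p , trans i≡ (sym (+-suc o (toℕ p))) , x≡)
            (All-enumerate (suc o) c)

  -- The default 0 is met only in table entries that no query uses, those of cores that are empty or
  -- stick out of the sequence.
  positionAt : List (ℕ × A) → ℕ → ℕ
  positionAt xs k = maybe′ proj₁ 0 (head (drop k xs))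

  positionAt-toℕ : ∀ xs (k : Fin (length xs)) → positionAt xs (toℕ k) ≡ proj₁ (lookup xs k)
  positionAt-toℕ (x ∷ xs) Fin.zero    = refl
  positionAt-toℕ (x ∷ xs) (Fin.suc k) = positionAt-toℕ xs k

module _ {f} (F : FixedRank f) where
  open FixedRank F

  rank-mono : ∀ x δ → 1 ≤ x → f x ≤ f (x + δ)
  rank-mono x zero    1≤x rewrite +-identityʳ x = ≤-refl
  rank-mono x (suc δ) 1≤x rewrite +-suc x δ =
    ≤-trans (rank-mono x δ 1≤x) (monotone (x + δ) (m≤n⇒m≤n+o δ 1≤x))

  rank-Lipschitz : ∀ x δ → 1 ≤ x → f (x + δ) ≤ f x + δ
  rank-Lipschitz x zero    1≤x rewrite +-identityʳ x | +-identityʳ (f x) = ≤-refl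
  rank-Lipschitz x (suc δ) 1≤x rewrite +-suc x δ = begin
    f (suc (x + δ))  ≤⟨ increment (x + δ) (m≤n⇒m≤n+o δ 1≤x) ⟩
    f (x + δ) + 1    ≤⟨ +-monoˡ-≤ 1 (rank-Lipschitz x δ 1≤x) ⟩
    f x + δ + 1      ≡⟨ +-assoc (f x) δ 1 ⟩
    f x + (δ + 1)    ≡⟨ cong (f x +_) (+-comm δ 1) ⟩
    f x + suc δ      ∎
    where open ≤-Reasoning

module _ {ℓ ℓ₁ ℓ₂} (O : TotalOrder ℓ ℓ₁ ℓ₂) where
  open TotalOrder O using (Carrier; total) renaming (trans to ≤O-trans; _≤_ to _≤O_; module Eq to EqO)

  -- Positions are ignored by the comparison and merely travel along, so that a range can still be
  -- cut out after sorting.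
  _≼_ : Rel (ℕ × Carrier) ℓ₂
  _≼_ = _≤O_ on proj₂

  ≼-total : Total _≼_
  ≼-total (_ , x) (_ , y) = total x y

  module _ {n} (c : Vec Carrier n) where

    ranking : List (ℕ × Carrier)
    ranking = insertionSort ≼-total (enumerate 0 (toList c))

    ranked : (lo hi : ℕ) → List (ℕ × Carrier)
    ranked lo hi = filter (within? lo hi) ranking

    values-↭ : ∀ lo hi → map proj₂ (ranked lo hi) ↭ take (hi ∸ lo) (drop lo (toList c))
    values-↭ lo hi = ↭-trans
      (map⁺-↭ proj₂ (filter-↭ (within? lo hi) (insertionSort-↭ ≼-total (enumerate 0 (toList c)))))
      (↭-reflexive (filter-within hi (toList c) z≤n))

    length-ranked : ∀ lo hi → hi ≤ n → length (ranked lo hi) ≡ hi ∸ lo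
    length-ranked lo hi hi≤n = begin
      length (ranked lo hi)                                ≡⟨ length-map proj₂ (ranked lo hi) ⟨
      length (map proj₂ (ranked lo hi))                    ≡⟨ ↭-length (values-↭ lo hi) ⟩
      length (take (hi ∸ lo) (drop lo (toList c)))         ≡⟨ length-take (hi ∸ lo) _ ⟩
      (hi ∸ lo) ⊓ length (drop lo (toList c))              ≡⟨ cong ((hi ∸ lo) ⊓_) (length-drop lo (toList c)) ⟩
      (hi ∸ lo) ⊓ (length (toList c) ∸ lo)                 ≡⟨ cong (λ z → (hi ∸ lo) ⊓ (z ∸ lo)) (length-toList c) ⟩
      (hi ∸ lo) ⊓ (n ∸ lo)                                 ≡⟨ m≤n⇒m⊓n≡m (∸-monoˡ-≤ lo hi≤n) ⟩
      hi ∸ lo                                              ∎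
      where open ≡-Reasoning

    ranked-entry : ∀ lo hi (k : Fin (length (ranked lo hi))) → let (i , x) = lookup (ranked lo hi) k in
      (lo ≤ i × i < hi) × ∃[ p ] i ≡ toℕ p × x ≡ Vec.lookup c p
    ranked-entry lo hi k =
      All.lookup (all-filter (within? lo hi) ranking) (∈-lookup k) ,
      All.lookup (All.filter⁺ (within? lo hi)
                   (All-resp-↭ (↭-sym (insertionSort-↭ ≼-total _)) (All-enumerate 0 c)))
                 (∈-lookup k)

    hasRank : ∀ a b (k : Fin (length (ranked (toℕ a) (suc (toℕ b))))) → a Fin.≤ b →
      HasRank O (range c a b) (suc (toℕ k)) (proj₂ (lookup (ranked (toℕ a) (suc (toℕ b))) k))
    hasRank a b k a≤b =
      map proj₂ rs ,
      subst (λ s → map proj₂ rs ↭ take s (drop (toℕ a) (toList c)))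
            (+-∸-assoc 1 a≤b) (values-↭ (toℕ a) (suc (toℕ b))) ,
      Linked.map⁺ (Linked.filter⁺ (within? (toℕ a) (suc (toℕ b))) ≤O-trans
                    (insertionSort-linked ≼-total (enumerate 0 (toList c)))) ,
      Fin.cast (sym (length-map proj₂ rs)) k ,
      cong suc (sym (toℕ-cast (sym (length-map proj₂ rs)) k)) ,
      EqO.reflexive (lookup-map-cast proj₂ rs k)
      where
      rs : List (ℕ × Carrier)
      rs = ranked (toℕ a) (suc (toℕ b))

    module _ (f : ℕ → ℕ) where

      -- An offset from `lo` instead of a position: being below `len`, it fits in the few bits
      -- reserved at its level. Ranks count from 1 and list indices from 0, hence `f len ∸ 1`.
      select : (lo len : ℕ) → ℕ
      select lo len = positionAt (ranked lo (lo + len)) (f len ∸ 1) ∸ lo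

      module _ (F : FixedRank f) {lo len} (1≤len : 1 ≤ len) (fits : lo + len ≤ n) where
        open FixedRank F

        private
          rank-fits : f len ∸ 1 < length (ranked lo (lo + len))
          rank-fits = begin
            suc (f len ∸ 1)                  ≡⟨ m+[n∸m]≡n (positive len 1≤len) ⟩
            f len                            ≤⟨ bounded len 1≤len ⟩
            len                              ≡⟨ m+n∸m≡n lo len ⟨
            lo + len ∸ lo                    ≡⟨ length-ranked lo (lo + len) fits ⟨
            length (ranked lo (lo + len))    ∎
            where open ≤-Reasoning

          rankIndex : Fin (length (ranked lo (lo + len)))
          rankIndex = Fin.fromℕ< rank-fits

          toℕ-rankIndex : suc (toℕ rankIndex) ≡ f len
          toℕ-rankIndex = trans (cong suc (toℕ-fromℕ< rank-fits)) (m+[n∸m]≡n (positive len 1≤len))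

          selected : ℕ × Carrier
          selected = lookup (ranked lo (lo + len)) rankIndex

          lo≤selected : lo ≤ proj₁ selected
          lo≤selected = proj₁ (proj₁ (ranked-entry lo (lo + len) rankIndex))

          lo+select : lo + select lo len ≡ proj₁ selected
          lo+select = begin
            lo + (positionAt (ranked lo (lo + len)) (f len ∸ 1) ∸ lo)
              ≡⟨ cong (λ k → lo + (positionAt (ranked lo (lo + len)) k ∸ lo)) (toℕ-fromℕ< rank-fits) ⟨
            lo + (positionAt (ranked lo (lo + len)) (toℕ rankIndex) ∸ lo)
              ≡⟨ cong (λ i → lo + (i ∸ lo)) (positionAt-toℕ (ranked lo (lo + len)) rankIndex) ⟩
            lo + (proj₁ selected ∸ lo)
              ≡⟨ m+[n∸m]≡n lo≤selected ⟩
            proj₁ selected ∎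
            where open ≡-Reasoning

        select-< : select lo len < len
        select-< = +-cancelˡ-< lo _ _ (subst (_< lo + len) (sym lo+select)
          (proj₂ (proj₁ (ranked-entry lo (lo + len) rankIndex))))

        -- Passing from the core to the range adds `δ` entries. This raises the index of the entry
        -- by something between 0 and `δ`, and the target rank by something between 0 and `δ` as
        -- well. Both shifts have the same sign, so they differ by at most `δ`, not `2 δ`. The lower
        -- bound uses that `f` is 1-Lipschitz, the upper one that it is monotone.
        select-rank : ∀ {a b : Fin n} {δ} → a Fin.≤ b → toℕ a ≤ lo → lo + len ≤ suc (toℕ b) →
          len + δ ≡ rangeSize a b →
          ∃[ p ] toℕ p ≡ lo + select lo len × a Fin.≤ p × p Fin.≤ b ×
            ∃[ i ] HasRank O (range c a b) i (Vec.lookup c p)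
                 × f (rangeSize a b) ≤ i + δ × i ≤ f (rangeSize a b) + δ
        select-rank {a} {b} {δ} a≤b a≤lo hi≤b len+δ
          with k , k≡ , j≤k , k≤j ← lookup-filter-⊆ (within? lo (lo + len)) (within? (toℕ a) (suc (toℕ b)))
                 (λ (lo≤i , i<hi) → ≤-trans a≤lo lo≤i , ≤-trans i<hi hi≤b) ranking rankIndex
          with (a≤i , i≤b) , p , i≡p , x≡ ← ranked-entry (toℕ a) (suc (toℕ b)) k
          = p , trans (sym i≡p) (trans (cong proj₁ k≡) (sym lo+select)) ,
            subst (toℕ a ≤_) i≡p a≤i , subst (_≤ toℕ b) i≡p (s≤s⁻¹ i≤b) ,
            suc (toℕ k) , subst (HasRank O (range c a b) (suc (toℕ k))) x≡ (hasRank a b k a≤b) ,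
            lower , upper
          where
          open ≤-Reasoning
          lower : f (rangeSize a b) ≤ suc (toℕ k) + δ
          lower = begin
            f (rangeSize a b)       ≡⟨ cong f len+δ ⟨
            f (len + δ)             ≤⟨ rank-Lipschitz F len δ 1≤len ⟩
            f len + δ               ≡⟨ cong (_+ δ) toℕ-rankIndex ⟨
            suc (toℕ rankIndex) + δ ≤⟨ +-monoˡ-≤ δ (s≤s j≤k) ⟩
            suc (toℕ k) + δ         ∎
          upper : suc (toℕ k) ≤ f (rangeSize a b) + δ
          upper = begin
            suc (toℕ k)              ≤⟨ +-cancelʳ-≤ len _ _ (begin
              suc (toℕ k) + len              ≡⟨ cong (suc (toℕ k) +_) (trans (length-ranked lo (lo + len) fits) (m+n∸m≡n lo len)) ⟨
              suc (toℕ k) + length (ranked lo (lo + len)) ≤⟨ s≤s k≤j ⟩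
              suc (toℕ rankIndex) + length (ranked (toℕ a) (suc (toℕ b))) ≡⟨ cong (suc (toℕ rankIndex) +_)
                 (trans (length-ranked (toℕ a) (suc (toℕ b)) (toℕ<n b)) (trans (+-∸-assoc 1 a≤b) (sym len+δ))) ⟩
              suc (toℕ rankIndex) + (len + δ)  ≡⟨ cong₂ _+_ toℕ-rankIndex (+-comm len δ) ⟩
              f len + (δ + len)                ≡⟨ +-assoc (f len) δ len ⟨
              f len + δ + len                  ∎) ⟩
            f len + δ                ≤⟨ +-monoˡ-≤ δ (rank-mono F len δ 1≤len) ⟩
            f (len + δ) + δ          ≡⟨ cong (λ s → f s + δ) len+δ ⟩
            f (rangeSize a b) + δ    ∎

-- Cuts and powers of one half

module ℚ* = CommutativeSemigroup (CommutativeMonoid.commutativeSemigroup ℚ.*-1-commutativeMonoid)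

-- Division in ℚ normalises by a gcd, which does not reduce for a variable `n`; the explicit
-- fraction exposes numerator and denominator to the arithmetic.
fromℕ≡mkℚ : ∀ n → fromℕ n ≡ mkℚ (ℤ.+ n) 0 (coprime-sym (1-coprimeTo n))
fromℕ≡mkℚ n = ℚ.normalize-coprime (coprime-sym (1-coprimeTo n))

fromℕ-+ : ∀ m n → fromℕ (m + n) ≡ fromℕ m ℚ.+ fromℕ n
fromℕ-+ m n rewrite fromℕ≡mkℚ m | fromℕ≡mkℚ n =
  cong (ℚ._/ 1) (sym (cong₂ ℤ._+_ (ℤ.*-identityʳ (ℤ.+ m)) (ℤ.*-identityʳ (ℤ.+ n))))

fromℕ-* : ∀ m n → fromℕ (m * n) ≡ fromℕ m ℚ.* fromℕ n
fromℕ-* m n rewrite fromℕ≡mkℚ m | fromℕ≡mkℚ n = cong (ℚ._/ 1) (ℤ.pos-* m n)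

fromℕ-mono-≤ : ∀ {m n} → m ≤ n → fromℕ m ℚ.≤ fromℕ n
fromℕ-mono-≤ {m} {n} m≤n rewrite fromℕ≡mkℚ m | fromℕ≡mkℚ n =
  ℚ.*≤* (ℤ.*-monoʳ-≤-nonNeg (ℤ.+ 1) (ℤ.+≤+ m≤n))

fromℕ-mono-< : ∀ {m n} → m < n → fromℕ m ℚ.< fromℕ n
fromℕ-mono-< {m} {n} m<n rewrite fromℕ≡mkℚ m | fromℕ≡mkℚ n =
  ℚ.*<* (ℤ.*-monoʳ-<-pos (ℤ.+ 1) (ℤ.+<+ m<n))

fromℕ-nonNeg : ∀ n → ℚ.NonNegative (fromℕ n)
fromℕ-nonNeg n = ℚ.normalize-nonNeg n 1

½^_ : ℕ → ℚ
½^ zero  = 1ℚ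
½^ suc e = ½ ℚ.* ½^ e

½^-pos : ∀ e → ℚ.Positive (½^ e)
½^-pos zero    = _
½^-pos (suc e) = ℚ.pos*pos⇒pos ½ (½^ e) {{½^-pos e}}

½^e*2^e : ∀ e → ½^ e ℚ.* fromℕ (2 ^ e) ≡ 1ℚ
½^e*2^e zero    = refl
½^e*2^e (suc e) = begin
  ½ ℚ.* ½^ e ℚ.* fromℕ (2 * 2 ^ e)             ≡⟨ cong (½ ℚ.* ½^ e ℚ.*_) (trans (cong fromℕ (*-comm 2 (2 ^ e))) (fromℕ-* (2 ^ e) 2)) ⟩
  ½ ℚ.* ½^ e ℚ.* (fromℕ (2 ^ e) ℚ.* fromℕ 2)   ≡⟨ ℚ.*-assoc ½ (½^ e) _ ⟩
  ½ ℚ.* (½^ e ℚ.* (fromℕ (2 ^ e) ℚ.* fromℕ 2)) ≡⟨ cong (½ ℚ.*_) (ℚ.*-assoc (½^ e) (fromℕ (2 ^ e)) (fromℕ 2)) ⟨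
  ½ ℚ.* (½^ e ℚ.* fromℕ (2 ^ e) ℚ.* fromℕ 2)   ≡⟨ cong (λ x → ½ ℚ.* (x ℚ.* fromℕ 2)) (½^e*2^e e) ⟩
  1ℚ                                            ∎
  where open ≡-Reasoning

½^-suc : ∀ e → ½^ suc e ℚ.< ½^ e
½^-suc e = subst (½ ℚ.* ½^ e ℚ.<_) (ℚ.*-identityˡ (½^ e))
  (ℚ.*-monoˡ-<-pos (½^ e) {{½^-pos e}} ½<1)
  where
  ½<1 : ½ ℚ.< 1ℚ
  ½<1 = ℚ.*<* (ℤ.+<+ (s≤s (s≤s z≤n)))

4*½^[2+e] : ∀ e → fromℕ 4 ℚ.* ½^ suc (suc e) ≡ ½^ e
4*½^[2+e] e = begin
  fromℕ 4 ℚ.* (½ ℚ.* (½ ℚ.* ½^ e))   ≡⟨ ℚ.*-assoc (fromℕ 4) ½ (½ ℚ.* ½^ e) ⟨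
  fromℕ 4 ℚ.* ½ ℚ.* (½ ℚ.* ½^ e)     ≡⟨ ℚ.*-assoc (fromℕ 4 ℚ.* ½) ½ (½^ e) ⟨
  fromℕ 4 ℚ.* ½ ℚ.* ½ ℚ.* ½^ e       ≡⟨ ℚ.*-identityˡ (½^ e) ⟩
  ½^ e                               ∎
  where open ≡-Reasoning

n<2^n : ∀ n → n < 2 ^ n
n<2^n zero    = s≤s z≤n
n<2^n (suc n) = ≤-trans (+-mono-≤ (≤-trans (s≤s z≤n) (n<2^n n)) (n<2^n n))
  (≤-reflexive (cong (λ k → 2 ^ n + k) (sym (+-identityʳ (2 ^ n)))))

-- The exponent is the denominator `d` of `q`: as `d < 2 ^ d`, multiplying by `d` gives
-- `½^ d * d < 1 ≤ q * d`.
½^-below : ∀ q → 0ℚ ℚ.< q → ∃[ e ] ½^ e ℚ.< q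
½^-below q@(mkℚ (ℤ.+ zero) d-1 c) (ℚ.*<* (ℤ.+<+ ()))
½^-below q@(mkℚ ℤ.+[1+ n ] d-1 c) _ = d ,
  ℚ.*-cancelʳ-<-nonNeg (fromℕ d) {{fromℕ-nonNeg d}} (begin-strict
    ½^ d ℚ.* fromℕ d        <⟨ ℚ.*-monoʳ-<-pos (½^ d) {{½^-pos d}} (fromℕ-mono-< (n<2^n d)) ⟩
    ½^ d ℚ.* fromℕ (2 ^ d)  ≡⟨ ½^e*2^e d ⟩
    1ℚ                      ≤⟨ 1≤q*d ⟩
    q ℚ.* fromℕ d           ∎)
  where
  open ℚ.≤-Reasoning
  d = suc d-1
  1≤q*d : 1ℚ ℚ.≤ q ℚ.* fromℕ d
  1≤q*d rewrite fromℕ≡mkℚ d = ℚ.toℚᵘ-cancel-≤ (ℚᵘ.≤-respʳ-≃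
    (ℚᵘ.≃-sym (ℚ.toℚᵘ-homo-* q (mkℚ (ℤ.+ d) 0 (coprime-sym (1-coprimeTo d)))))
    (ℚᵘ.*≤* (ℤ.+≤+ (≤-trans (≤-reflexive (*-identityˡ (d * 1))) (*-monoˡ-≤ 1 (m≤m+n d (n * d)))))))

module _ (α : ℝ) where
  open ℝ α using (below-rounded; above-rounded; disjoint; located)

  <ℝ-downward : ∀ {p q} → p ℚ.< q → q <ℝ α → p <ℝ α
  <ℝ-downward {p} {q} p<q q<α = Equivalence.from (below-rounded p) (q , p<q , q<α)

  ℝ<-upward : ∀ {p q} → p ℚ.< q → α ℝ< p → α ℝ< q
  ℝ<-upward {p} {q} p<q α<p = Equivalence.from (above-rounded q) (p , p<q , α<p)

  below≤above : ∀ {p q} → p <ℝ α → α ℝ< q → p ℚ.≤ q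
  below≤above {p} {q} p<α α<q =
    ℚ.≮⇒≥ λ q<p → disjoint p (p<α , ℝ<-upward q<p α<q)

  -- Locatedness separates α only from one of two distinct rationals, here `½^ suc e` and `½^ e`.
  -- Either the smaller one is below α and the search ends, or the larger one is above α, and it
  -- equals the upper bound wanted for `suc e`. This overlap is why the ratio is 4. The sum
  -- `e + fuel` stays constant, so the known lower bound ends the search at the latest when the fuel
  -- is spent.
  bracket-from : ∀ fuel e → α ℝ< fromℕ 4 ℚ.* ½^ suc e → ½^ (e + fuel) <ℝ α →
    ∃[ e′ ] ½^ suc e′ <ℝ α × α ℝ< fromℕ 4 ℚ.* ½^ suc e′
  bracket-from zero       e α<u r<α =
    e , <ℝ-downward (½^-suc e) (subst (λ k → ½^ k <ℝ α) (+-identityʳ e) r<α) , α<u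
  bracket-from (suc fuel) e α<u r<α with located (½^ suc e) (½^ e) (½^-suc e)
  ... | inj₁ r′<α = e , r′<α , α<u
  ... | inj₂ α<r  = bracket-from fuel (suc e)
    (subst (α ℝ<_) (sym (4*½^[2+e] e)) α<r)
    (subst (λ k → ½^ k <ℝ α) (+-suc e fuel) r<α)

  bracket : 0ℚ <ℝ α → α ℝ< ½ → ∃[ e ] ½^ suc e <ℝ α × α ℝ< fromℕ 4 ℚ.* ½^ suc e
  bracket 0<α α<½
    with q , 0<q , q<α ← Equivalence.to (below-rounded 0ℚ) 0<α
    with fuel , r<q ← ½^-below q 0<q
    -- The initial upper bound is `4 * ½ = 2`, which exceeds `½`.
    = bracket-from fuel 0 (ℝ<-upward (ℚ.*<* (ℤ.+<+ (s≤s (s≤s z≤n)))) α<½) (<ℝ-downward r<q q<α)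

  module _ {e} (r<α : ½^ e <ℝ α) where

    approxRank : ∀ {k s i δ} → δ * 2 ^ e ≤ s → k ≤ i + δ → i ≤ k + δ → ApproxRank α k s i
    approxRank {k} {s} {i} {δ} δ≤ k≤i+δ i≤k+δ q α<q = lower , upper
      where
      open ℚ.≤-Reasoning
      δ≤qs : fromℕ δ ℚ.≤ q ℚ.* fromℕ s
      δ≤qs = begin
        fromℕ δ                                ≡⟨ ℚ.*-identityʳ (fromℕ δ) ⟨
        fromℕ δ ℚ.* 1ℚ                         ≡⟨ cong (fromℕ δ ℚ.*_) (trans (ℚ.*-comm (fromℕ (2 ^ e)) (½^ e)) (½^e*2^e e)) ⟨
        fromℕ δ ℚ.* (fromℕ (2 ^ e) ℚ.* ½^ e)   ≡⟨ ℚ.*-assoc (fromℕ δ) (fromℕ (2 ^ e)) (½^ e) ⟨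
        fromℕ δ ℚ.* fromℕ (2 ^ e) ℚ.* ½^ e     ≡⟨ cong (ℚ._* ½^ e) (fromℕ-* δ (2 ^ e)) ⟨
        fromℕ (δ * 2 ^ e) ℚ.* ½^ e             ≤⟨ ℚ.*-monoʳ-≤-nonNeg (½^ e) {{ℚ.pos⇒nonNeg (½^ e) {{½^-pos e}}}} (fromℕ-mono-≤ δ≤) ⟩
        fromℕ s ℚ.* ½^ e                       ≤⟨ ℚ.*-monoˡ-≤-nonNeg (fromℕ s) {{fromℕ-nonNeg s}} (below≤above r<α α<q) ⟩
        fromℕ s ℚ.* q                          ≡⟨ ℚ.*-comm (fromℕ s) q ⟩
        q ℚ.* fromℕ s                          ∎
      shift : ∀ {x y} → x ≤ y + δ → fromℕ x ℚ.≤ fromℕ y ℚ.+ q ℚ.* fromℕ s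
      shift {x} {y} x≤ = begin
        fromℕ x                        ≤⟨ fromℕ-mono-≤ x≤ ⟩
        fromℕ (y + δ)                  ≡⟨ fromℕ-+ y δ ⟩
        fromℕ y ℚ.+ fromℕ δ            ≤⟨ ℚ.+-monoʳ-≤ (fromℕ y) δ≤qs ⟩
        fromℕ y ℚ.+ q ℚ.* fromℕ s      ∎
      upper = shift i≤k+δ
      lower = begin
        fromℕ k ℚ.- q ℚ.* fromℕ s                            ≤⟨ ℚ.+-monoˡ-≤ (ℚ.- (q ℚ.* fromℕ s)) (shift k≤i+δ) ⟩
        fromℕ i ℚ.+ q ℚ.* fromℕ s ℚ.- q ℚ.* fromℕ s          ≡⟨ ℚ.+-assoc (fromℕ i) _ _ ⟩
        fromℕ i ℚ.+ (q ℚ.* fromℕ s ℚ.- q ℚ.* fromℕ s)        ≡⟨ cong (fromℕ i ℚ.+_) (ℚ.+-inverseʳ (q ℚ.* fromℕ s)) ⟩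
        fromℕ i ℚ.+ 0ℚ                                       ≡⟨ ℚ.+-identityʳ (fromℕ i) ⟩
        fromℕ i                                              ∎

  module _ {e} (α<u : α ℝ< fromℕ 4 ℚ.* ½^ e) where

    -- Each tested `q` lies below α, hence `2 ^ e * q ≤ 4`; the square of this is the 16.
    spaceBound : ∀ C n bits → bits ≤ C * n * (2 ^ e * 2 ^ e) → SpaceBound (16 * C) n α bits
    spaceBound C n bits bits≤ q 0<q q<α = begin
      fromℕ bits ℚ.* (q ℚ.* q)
        ≤⟨ ℚ.*-monoʳ-≤-nonNeg (q ℚ.* q)
             {{ℚ.pos⇒nonNeg (q ℚ.* q) {{ℚ.pos*pos⇒pos q {{ℚ.positive 0<q}} q {{ℚ.positive 0<q}}}}}} (fromℕ-mono-≤ bits≤) ⟩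
      fromℕ (C * n * (M * M)) ℚ.* (q ℚ.* q)
        ≡⟨ cong (ℚ._* (q ℚ.* q)) (trans (fromℕ-* (C * n) (M * M)) (cong (fromℕ (C * n) ℚ.*_) (fromℕ-* M M))) ⟩
      fromℕ (C * n) ℚ.* (fromℕ M ℚ.* fromℕ M) ℚ.* (q ℚ.* q)
        ≡⟨ ℚ.*-assoc (fromℕ (C * n)) _ _ ⟩
      fromℕ (C * n) ℚ.* (fromℕ M ℚ.* fromℕ M ℚ.* (q ℚ.* q))
        ≡⟨ cong (fromℕ (C * n) ℚ.*_) (ℚ*.interchange (fromℕ M) (fromℕ M) q q) ⟩
      fromℕ (C * n) ℚ.* (fromℕ M ℚ.* q ℚ.* (fromℕ M ℚ.* q))
        ≤⟨ ℚ.*-monoˡ-≤-nonNeg (fromℕ (C * n)) {{fromℕ-nonNeg (C * n)}}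
             (ℚ.≤-trans (ℚ.*-monoʳ-≤-nonNeg (fromℕ M ℚ.* q) {{Mq≥0}} Mq≤4) (ℚ.*-monoˡ-≤-nonNeg (fromℕ 4) Mq≤4)) ⟩
      fromℕ (C * n) ℚ.* fromℕ 16
        ≡⟨ fromℕ-* (C * n) 16 ⟨
      fromℕ (C * n * 16)
        ≡⟨ cong fromℕ (rearrange C n) ⟩
      fromℕ (16 * C * n) ∎
      where
      open ℚ.≤-Reasoning
      M = 2 ^ e
      rearrange : ∀ C n → C * n * 16 ≡ 16 * C * n
      rearrange = solve-∀
      Mq≥0 : ℚ.NonNegative (fromℕ M ℚ.* q)
      Mq≥0 = ℚ.nonNeg*nonNeg⇒nonNeg (fromℕ M) {{fromℕ-nonNeg M}} q {{ℚ.pos⇒nonNeg q {{ℚ.positive 0<q}}}}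
      Mq≤4 : fromℕ M ℚ.* q ℚ.≤ fromℕ 4
      Mq≤4 = begin
        fromℕ M ℚ.* q                      ≤⟨ ℚ.*-monoˡ-≤-nonNeg (fromℕ M) {{fromℕ-nonNeg M}} (below≤above q<α α<u) ⟩
        fromℕ M ℚ.* (fromℕ 4 ℚ.* ½^ e)     ≡⟨ ℚ.*-comm (fromℕ M) _ ⟩
        fromℕ 4 ℚ.* ½^ e ℚ.* fromℕ M       ≡⟨ ℚ.*-assoc (fromℕ 4) (½^ e) (fromℕ M) ⟩
        fromℕ 4 ℚ.* (½^ e ℚ.* fromℕ M)     ≡⟨ cong (fromℕ 4 ℚ.*_) (½^e*2^e e) ⟩
        fromℕ 4 ℚ.* 1ℚ                     ≡⟨ ℚ.*-identityʳ (fromℕ 4) ⟩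
        fromℕ 4                            ∎

-- Levels and grids

<2^1+log : ∀ n → n < 2 ^ suc ⌊log₂ n ⌋
<2^1+log n = ≰⇒> λ 2^≤n → 1+n≰n (subst (_≤ ⌊log₂ n ⌋) (⌊log₂[2^n]⌋≡n (suc ⌊log₂ n ⌋)) (⌊log₂⌋-mono-≤ 2^≤n))

2*⌊n/2⌋≤n : ∀ n → 2 * ⌊ n /2⌋ ≤ n
2*⌊n/2⌋≤n n = begin
  ⌊ n /2⌋ + (⌊ n /2⌋ + 0)   ≡⟨ cong (⌊ n /2⌋ +_) (+-identityʳ ⌊ n /2⌋) ⟩
  ⌊ n /2⌋ + ⌊ n /2⌋         ≤⟨ +-monoʳ-≤ ⌊ n /2⌋ (⌊n/2⌋≤⌈n/2⌉ n) ⟩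
  ⌊ n /2⌋ + ⌈ n /2⌉         ≡⟨ ⌊n/2⌋+⌈n/2⌉≡n n ⟩
  n                         ∎
  where open ≤-Reasoning

n≤1+2*⌊n/2⌋ : ∀ n → n ≤ suc (2 * ⌊ n /2⌋)
n≤1+2*⌊n/2⌋ 0             = z≤n
n≤1+2*⌊n/2⌋ 1             = ≤-refl
n≤1+2*⌊n/2⌋ (suc (suc n)) rewrite +-suc ⌊ n /2⌋ (⌊ n /2⌋ + 0) = s≤s (s≤s (n≤1+2*⌊n/2⌋ n))

2^log≤ : ∀ n → 1 ≤ n → 2 ^ ⌊log₂ n ⌋ ≤ n
2^log≤ = <-rec (λ n → 1 ≤ n → 2 ^ ⌊log₂ n ⌋ ≤ n) step
  where
  open ≤-Reasoning
  step : ∀ n → (∀ {k} → k < n → 1 ≤ k → 2 ^ ⌊log₂ k ⌋ ≤ k) → 1 ≤ n → 2 ^ ⌊log₂ n ⌋ ≤ n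
  step 1               rec _ = ≤-refl
  step n@(suc (suc k)) rec _ = begin
    2 ^ ⌊log₂ n ⌋                     ≤⟨ ^-monoʳ-≤ 2 (m≤n+m∸n ⌊log₂ n ⌋ 1) ⟩
    2 * 2 ^ (⌊log₂ n ⌋ ∸ 1)           ≡⟨ cong (λ e → 2 * 2 ^ e) (⌊log₂⌊n/2⌋⌋≡⌊log₂n⌋∸1 n) ⟨
    2 * 2 ^ ⌊log₂ ⌊ n /2⌋ ⌋           ≤⟨ *-monoʳ-≤ 2 (rec (⌊n/2⌋<n (suc k)) (s≤s z≤n)) ⟩
    2 * ⌊ n /2⌋                       ≤⟨ 2*⌊n/2⌋≤n n ⟩
    n                                 ∎

2^[i+i] : ∀ i → 2 ^ (i + i) ≡ 2 ^ i * 2 ^ i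
2^[i+i] i = ^-distribˡ-+-* 2 i i

module _ (c : ℕ) (1≤c : 1 ≤ c) where
  private
    i = ⌊ ⌊log₂ c ⌋ /2⌋
    i+i : 2 * i ≡ i + i
    i+i = cong (i +_) (+-identityʳ i)

  4^level≤ : 2 ^ i * 2 ^ i ≤ c
  4^level≤ = begin
    2 ^ i * 2 ^ i     ≡⟨ 2^[i+i] i ⟨
    2 ^ (i + i)       ≤⟨ ^-monoʳ-≤ 2 (subst (_≤ ⌊log₂ c ⌋) i+i (2*⌊n/2⌋≤n ⌊log₂ c ⌋)) ⟩
    2 ^ ⌊log₂ c ⌋     ≤⟨ 2^log≤ c 1≤c ⟩
    c                 ∎
    where open ≤-Reasoning

  -- Halving the logarithm loses at most one bit, log₂ c ≤ 2 i + 1, which together with the rounding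
  -- of the logarithm itself gives the 4.
  <4*4^level : c < 4 * (2 ^ i * 2 ^ i)
  <4*4^level = begin-strict
    c                       <⟨ <2^1+log c ⟩
    2 * 2 ^ ⌊log₂ c ⌋       ≤⟨ *-monoʳ-≤ 2 (^-monoʳ-≤ 2 (n≤1+2*⌊n/2⌋ ⌊log₂ c ⌋)) ⟩
    2 * (2 * 2 ^ (2 * i))   ≡⟨ cong (λ e → 2 * (2 * 2 ^ e)) i+i ⟩
    2 * (2 * 2 ^ (i + i))   ≡⟨ *-assoc 2 2 (2 ^ (i + i)) ⟨
    4 * 2 ^ (i + i)         ≡⟨ cong (4 *_) (2^[i+i] i) ⟩
    4 * (2 ^ i * 2 ^ i)     ∎
    where open ≤-Reasoning

m<[1+m/n]*n : ∀ m n .{{_ : NonZero n}} → m < suc (m / n) * n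
m<[1+m/n]*n m n = subst (_< n + m / n * n) (sym (m≡m%n+[m/n]*n m n)) (+-monoˡ-< (m / n * n) (m%n<n m n))

m*n≤o⇒m≤o/n : ∀ m n o .{{_ : NonZero n}} → m * n ≤ o → m ≤ o / n
m*n≤o⇒m≤o/n m n o mn≤o = subst (_≤ o / n) (m*n/n≡m m n) (/-monoˡ-≤ n mn≤o)

-- Slots 0 … H − 1 describe multiples of H; slots H … 2 H − 1 describe sizes below H.
module _ (H : ℕ) .{{_ : NonZero H}} where

  -- A case distinction without a jump: the comparison bit switches the first summand on or off, and
  -- the second one vanishes by itself when `s < H`.
  slot : ℕ → ℕ
  slot s = (s + H) * fromBool (s <ᵇ H) + s / H

  coarse : ℕ → ℕ
  coarse t = if t <ᵇ H then t * H else t ∸ H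

  -- Small sizes are recovered exactly. For `H ≤ s`, rounding down to a multiple of `H` loses less
  -- than `H`, and that multiple is itself at least `H`; hence the factor 2.
  coarse-slot : ∀ {s} → 1 ≤ s → s < H * H →
    1 ≤ coarse (slot s) × coarse (slot s) ≤ s × s < 2 * coarse (slot s) × slot s < 2 * H
  coarse-slot {s} 1≤s s<H² with s <ᵇ H in s<ᵇH
  ... | true = subst (λ t → 1 ≤ coarse t × coarse t ≤ s × s < 2 * coarse t × t < 2 * H) (sym slot≡)
                 (subst (λ c → 1 ≤ c × c ≤ s × s < 2 * c × s + H < 2 * H) (sym coarse≡)
                   (1≤s , ≤-refl , m<m+n s (subst (0 <_) (sym (+-identityʳ s)) 1≤s) ,
                    subst (s + H <_) (cong (H +_) (sym (+-identityʳ H))) (+-monoˡ-< H s<H)))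
    where
    s<H : s < H
    s<H = <ᵇ⇒< s H (subst T (sym s<ᵇH) _)
    slot≡ : (s + H) * 1 + s / H ≡ s + H
    slot≡ = trans (cong₂ _+_ (*-identityʳ (s + H)) (m<n⇒m/n≡0 s<H)) (+-identityʳ (s + H))
    coarse≡ : coarse (s + H) ≡ s
    coarse≡ with s + H <ᵇ H in lt′
    ... | true  = contradiction (<ᵇ⇒< (s + H) H (subst T (sym lt′) _)) (≤⇒≯ (m≤n+m H s))
    ... | false = m+n∸n≡m s H
  ... | false = subst (λ t → 1 ≤ coarse t × coarse t ≤ s × s < 2 * coarse t × t < 2 * H) (sym slot≡)
                 (subst (λ c → 1 ≤ c × c ≤ s × s < 2 * c × s / H < 2 * H) (sym coarse≡)
                   (1≤c , m/n*n≤m s H , s<2c , <-≤-trans s/H<H (m≤n*m H 2)))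
    where
    H≤s : H ≤ s
    H≤s = ≮⇒≥ λ s<H → subst T s<ᵇH (<⇒<ᵇ s<H)
    s/H<H : s / H < H
    s/H<H = m<n*o⇒m/o<n {s} {H} {H} s<H²
    slot≡ : (s + H) * 0 + s / H ≡ s / H
    slot≡ = cong (_+ s / H) (*-zeroʳ (s + H))
    coarse≡ : coarse (s / H) ≡ s / H * H
    coarse≡ with s / H <ᵇ H in lt′
    ... | true  = refl
    ... | false = contradiction (subst T lt′ (<⇒<ᵇ s/H<H)) λ()
    H≤c : H ≤ s / H * H
    H≤c = m≤n*m H (s / H) {{>-nonZero (m≥n⇒m/n>0 H≤s)}}
    1≤c : 1 ≤ s / H * H
    1≤c = ≤-trans (>-nonZero⁻¹ H) H≤c
    s<2c : s < 2 * (s / H * H)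
    s<2c = begin-strict
      s                             <⟨ m<[1+m/n]*n s H ⟩
      H + s / H * H                 ≤⟨ +-monoˡ-≤ (s / H * H) H≤c ⟩
      s / H * H + s / H * H         ≡⟨ cong (s / H * H +_) (+-identityʳ (s / H * H)) ⟨
      2 * (s / H * H)               ∎
      where open ≤-Reasoning

-- γ + 1 is the grid spacing.
module Core {a b γ m N : ℕ} (a≤b : a ≤ b) (2≤m : 2 ≤ m) (γ≤ : γ * (2 * m) ≤ N) (N≤s : N ≤ suc (b ∸ a))
  where
  private
    g = suc γ
    s = suc (b ∸ a)
    a+s : a + s ≡ b + 1
    a+s = trans (+-suc a (b ∸ a)) (trans (cong suc (m+[n∸m]≡n a≤b)) (+-comm 1 b))

  -- Both in grid units. Since `g = γ + 1`, the first quotient is `a / g` rounded up; `coreEnd` is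
  -- exclusive, hence `b + 1`. Each rounding loses at most `γ` entries.
  coreStart coreEnd : ℕ
  coreStart = (a + γ) / g
  coreEnd   = (b + 1) / g

  coreStart≤ : coreStart * g ≤ a + γ
  coreStart≤ = m/n*n≤m (a + γ) g

  ≤coreStart : a ≤ coreStart * g
  ≤coreStart = +-cancelʳ-≤ γ a (coreStart * g) (s≤s⁻¹ (begin-strict
    a + γ                 <⟨ m<[1+m/n]*n (a + γ) g ⟩
    g + coreStart * g     ≡⟨ +-comm g (coreStart * g) ⟩
    coreStart * g + suc γ ≡⟨ +-suc (coreStart * g) γ ⟩
    suc (coreStart * g + γ) ∎))
    where open ≤-Reasoning

  coreEnd≤ : coreEnd * g ≤ b + 1
  coreEnd≤ = m/n*n≤m (b + 1) g

  ≤coreEnd : b + 1 ≤ coreEnd * g + γ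
  ≤coreEnd = s≤s⁻¹ (begin-strict
    b + 1                 <⟨ m<[1+m/n]*n (b + 1) g ⟩
    g + coreEnd * g       ≡⟨ +-comm g (coreEnd * g) ⟩
    coreEnd * g + suc γ   ≡⟨ +-suc (coreEnd * g) γ ⟩
    suc (coreEnd * g + γ) ∎)
    where open ≤-Reasoning

  2γm≤s : (γ + γ) * m ≤ s
  2γm≤s = begin
    (γ + γ) * m   ≡⟨ shuffle γ m ⟩
    γ * (2 * m)   ≤⟨ γ≤ ⟩
    N             ≤⟨ N≤s ⟩
    s             ∎
    where
    open ≤-Reasoning
    shuffle : ∀ γ m → (γ + γ) * m ≡ γ * (2 * m)
    shuffle = solve-∀

  -- Without a grid cell between the two roundings, the range would be covered by the two margins,
  -- so `s ≤ 2 γ`. But `2 γ m ≤ s` with `2 ≤ m` makes `s` at least twice `2 γ`; if `γ = 0`, it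
  -- suffices that `s` is positive.
  coreStart<coreEnd : coreStart < coreEnd
  coreStart<coreEnd = ≰⇒> λ e≤s → contradiction (s≤2γ e≤s) (<⇒≱ 2γ<s)
    where
    open ≤-Reasoning
    s≤2γ : coreEnd ≤ coreStart → s ≤ γ + γ
    s≤2γ e≤s = +-cancelˡ-≤ a s (γ + γ) (begin
      a + s                ≡⟨ a+s ⟩
      b + 1                ≤⟨ ≤coreEnd ⟩
      coreEnd * g + γ      ≤⟨ +-monoˡ-≤ γ (*-monoˡ-≤ g e≤s) ⟩
      coreStart * g + γ    ≤⟨ +-monoˡ-≤ γ coreStart≤ ⟩
      a + γ + γ            ≡⟨ +-assoc a γ γ ⟩
      a + (γ + γ)          ∎)
    2γ<s : γ + γ < s
    2γ<s with γ + γ in 2γ≡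
    ... | zero  = s≤s z≤n
    ... | suc k = begin-strict
      suc k       <⟨ m<m+n (suc k) (s≤s z≤n) ⟩
      suc k + suc k ≡⟨ cong (suc k +_) (+-identityʳ (suc k)) ⟨
      2 * suc k     ≡⟨ *-comm 2 (suc k) ⟩
      suc k * 2     ≤⟨ *-monoʳ-≤ (suc k) 2≤m ⟩
      suc k * m     ≡⟨ cong (_* m) 2γ≡ ⟨
      (γ + γ) * m   ≤⟨ 2γm≤s ⟩
      s             ∎

  coreCells : ℕ
  coreCells = coreEnd ∸ coreStart

  core-end : coreStart * g + coreCells * g ≡ coreEnd * g
  core-end = trans (sym (*-distribʳ-+ g coreStart coreCells))
                   (cong (_* g) (m+[n∸m]≡n (<⇒≤ coreStart<coreEnd)))

  1≤coreLength : 1 ≤ coreCells * g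
  1≤coreLength = *-mono-≤ {1} {coreCells} {1} {g} (m<n⇒0<n∸m coreStart<coreEnd) (s≤s z≤n)

  coreLength≤ : coreCells * g ≤ s
  coreLength≤ = +-cancelˡ-≤ a (coreCells * g) s (begin
    a + coreCells * g                ≤⟨ +-monoˡ-≤ (coreCells * g) ≤coreStart ⟩
    coreStart * g + coreCells * g    ≡⟨ core-end ⟩
    coreEnd * g                      ≤⟨ coreEnd≤ ⟩
    b + 1                            ≡⟨ a+s ⟨
    a + s                            ∎)
    where open ≤-Reasoning

  s≤coreLength : s ≤ coreCells * g + (γ + γ)
  s≤coreLength = +-cancelˡ-≤ a s (coreCells * g + (γ + γ)) (begin
    a + s                                 ≡⟨ a+s ⟩
    b + 1                                 ≤⟨ ≤coreEnd ⟩
    coreEnd * g + γ                       ≡⟨ cong (_+ γ) core-end ⟨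
    coreStart * g + coreCells * g + γ     ≤⟨ +-monoˡ-≤ γ (+-monoˡ-≤ (coreCells * g) coreStart≤) ⟩
    a + γ + coreCells * g + γ             ≡⟨ shuffle a γ (coreCells * g) ⟩
    a + (coreCells * g + (γ + γ))         ∎)
    where
    open ≤-Reasoning
    shuffle : ∀ a γ l → a + γ + l + γ ≡ a + (l + (γ + γ))
    shuffle = solve-∀

  lost-small : (s ∸ coreCells * g) * m ≤ s
  lost-small = ≤-trans (*-monoˡ-≤ m (m≤n+o⇒m∸n≤o s (coreCells * g) s≤coreLength)) 2γm≤s

-- Straight-line programs

infixl 7 _≫_ _mod2^_

_≫_ _mod2^_ : ℕ → ℕ → ℕ
x ≫ y     = _/_ x (2 ^ y) {{m^n≢0 2 y}}
x mod2^ y = _%_ x (2 ^ y) {{m^n≢0 2 y}}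

<⇒mod2^≡ : ∀ {x} w → x < 2 ^ w → x mod2^ w ≡ x
<⇒mod2^≡ w = m<n⇒m%n≡m {{m^n≢0 2 w}}

toℕ-wrap : ∀ w x → toℕ (wrap w x) ≡ x mod2^ w
toℕ-wrap w x = toℕ-fromℕ< (m%n<n x (2 ^ w) {{m^n≢0 2 w}})

drop-suc : ∀ {a} {A : Set a} n (xs : List A) {y ys} → drop n xs ≡ y ∷ ys → drop (suc n) xs ≡ ys
drop-suc zero    (x ∷ xs) refl = refl
drop-suc (suc n) (x ∷ xs) eq′  = drop-suc n xs eq′

module Arithmetic (w : ℕ) where

  _⟨_⟩_⇓_ : ℕ → Op → ℕ → ℕ → Set
  x ⟨ o ⟩ y ⇓ z = eval o w x y mod2^ w ≡ z

  ⇓add : ∀ x y → x + y < 2 ^ w → x ⟨ add ⟩ y ⇓ (x + y)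
  ⇓add x y = <⇒mod2^≡ w

  ⇓sub : ∀ x y → y ≤ x → x < 2 ^ w → x ⟨ sub ⟩ y ⇓ (x ∸ y)
  ⇓sub x y y≤x x<2^w = begin
    (x + 2 ^ w ∸ y) mod2^ w    ≡⟨ cong (λ k → (k ∸ y) mod2^ w) (+-comm x (2 ^ w)) ⟩
    (2 ^ w + x ∸ y) mod2^ w    ≡⟨ cong (_mod2^ w) (trans (+-∸-assoc (2 ^ w) y≤x) (+-comm (2 ^ w) (x ∸ y))) ⟩
    (x ∸ y + 2 ^ w) mod2^ w    ≡⟨ [m+n]%n≡m%n (x ∸ y) (2 ^ w) {{m^n≢0 2 w}} ⟩
    (x ∸ y) mod2^ w            ≡⟨ <⇒mod2^≡ w (≤-<-trans (m∸n≤m x y) x<2^w) ⟩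
    x ∸ y                      ∎
    where open ≡-Reasoning

  ⇓mul : ∀ x y → x * y < 2 ^ w → x ⟨ mul ⟩ y ⇓ (x * y)
  ⇓mul x y = <⇒mod2^≡ w

  ⇓div : ∀ x y .{{_ : NonZero y}} → x < 2 ^ w → x ⟨ div ⟩ y ⇓ (x / y)
  ⇓div x (suc y) x<2^w = <⇒mod2^≡ w (≤-<-trans (m/n≤m x (suc y)) x<2^w)

  ⇓mod : ∀ x y .{{_ : NonZero y}} → x < 2 ^ w → x ⟨ mod ⟩ y ⇓ (x % y)
  ⇓mod x (suc y) x<2^w = <⇒mod2^≡ w (≤-<-trans (m%n≤m x (suc y)) x<2^w)

  ⇓shr : ∀ x y → x < 2 ^ w → x ⟨ shr ⟩ y ⇓ (x ≫ y)
  ⇓shr x y x<2^w = <⇒mod2^≡ w (≤-<-trans (m/n≤m x (2 ^ y) {{m^n≢0 2 y}}) x<2^w)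

  ⇓lt : ∀ x y → 1 < 2 ^ w → x ⟨ lt ⟩ y ⇓ fromBool (x <ᵇ y)
  ⇓lt x y 1<2^w with x <ᵇ y
  ... | true  = <⇒mod2^≡ w 1<2^w
  ... | false = <⇒mod2^≡ w (m^n>0 2 w)

module _ (w : ℕ) (Cell : ℕ → ℕ → Set) where
  open Arithmetic w using (_⟨_⟩_⇓_)

  -- Jump-free and store-free executions with natural numbers in the registers. A trace asks for the
  -- exact result of each operation, so verifying the query becomes a list of no-overflow conditions
  -- and cell contents.
  data Trace : Program → (Reg → ℕ) → (Reg → ℕ) → Set where
    done  : ∀ {ρ} → Trace [] ρ ρ
    const : ∀ {is ρ ρ′ r x} → x < 2 ^ w → Trace is (ρ [ r ≔ x ]) ρ′ →
            Trace (const r x ∷ is) ρ ρ′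
    op    : ∀ {is ρ ρ′ o r s t z} → ρ s ⟨ o ⟩ ρ t ⇓ z → Trace is (ρ [ r ≔ z ]) ρ′ →
            Trace (op o r s t ∷ is) ρ ρ′
    load  : ∀ {is ρ ρ′ r s y} → Cell (ρ s) y → Trace is (ρ [ r ≔ y ]) ρ′ →
            Trace (load r s ∷ is) ρ ρ′

  _Represents_ : (Reg → Word w) → (Reg → ℕ) → Set
  regs Represents ρ = ∀ r → toℕ (regs r) ≡ ρ r

  represents-≔ : ∀ {regs ρ} r {x y} → regs Represents ρ → toℕ x ≡ y →
                 (regs [ r ≔ x ]) Represents (ρ [ r ≔ y ])
  represents-≔ r regs≈ρ x≡y r′ with r ≡ᵇ r′
  ... | true  = x≡y
  ... | false = regs≈ρ r′

  -- The equation for `drop pc P` ties the program counter to the remaining code. No traced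
  -- instruction jumps, so both advance together, and at the end `drop` yields the empty list, which
  -- is the halting condition of the machine.
  run-trace : ∀ P {mem} → (∀ u {y} → Cell (toℕ u) y → toℕ (mem u) ≡ y) →
    ∀ {is ρ ρ′} → Trace is ρ ρ′ → ∀ pc regs → drop pc P ≡ is → regs Represents ρ →
    Σ (State w) λ σ → run P (length is) (state pc regs mem) ≡ just σ
      × State.regs σ Represents ρ′ × State.mem σ ≡ mem
  run-trace P cells done pc regs pc≡ regs≈ρ rewrite pc≡ = _ , refl , regs≈ρ , refl
  run-trace P cells (const {r = r} {x} x<2^w tr) pc regs pc≡ regs≈ρ rewrite pc≡ =
    run-trace P cells tr (suc pc) (regs [ r ≔ wrap w x ]) (drop-suc pc P pc≡)
      (represents-≔ r regs≈ρ (trans (toℕ-wrap w x) (<⇒mod2^≡ w x<2^w)))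
  run-trace P cells (op {o = o} {r} {s} {t} ⇓z tr) pc regs pc≡ regs≈ρ rewrite pc≡ =
    run-trace P cells tr (suc pc) (regs [ r ≔ wrap w (eval o w (toℕ (regs s)) (toℕ (regs t))) ])
      (drop-suc pc P pc≡) (represents-≔ r regs≈ρ
        (trans (toℕ-wrap w _)
          (trans (cong₂ (λ x y → eval o w x y mod2^ w) (regs≈ρ s) (regs≈ρ t)) ⇓z)))
  run-trace P {mem} cells (load {r = r} {s} {y} cell tr) pc regs pc≡ regs≈ρ rewrite pc≡ =
    run-trace P cells tr (suc pc) (regs [ r ≔ mem (regs s) ]) (drop-suc pc P pc≡)
      (represents-≔ r regs≈ρ
        (cells (regs s) (subst (λ x → Cell x y) (sym (regs≈ρ s)) cell)))

-- Digits packed into words, and arrays interleaved in memory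

pack : ∀ v → ℕ → (ℕ → Word v) → ℕ
pack v zero    digits = 0
pack v (suc k) digits = toℕ (digits 0) + pack v k (λ r → digits (suc r)) * 2 ^ v

pack-< : ∀ v k digits → pack v k digits < 2 ^ (k * v)
pack-< v zero    digits = s≤s z≤n
pack-< v (suc k) digits = begin
  suc (toℕ (digits 0)) + pack v k (λ r → digits (suc r)) * 2 ^ v
    ≤⟨ +-monoˡ-≤ _ (toℕ<n (digits 0)) ⟩
  suc (pack v k (λ r → digits (suc r))) * 2 ^ v
    ≤⟨ *-monoˡ-≤ (2 ^ v) (pack-< v k (λ r → digits (suc r))) ⟩
  2 ^ (k * v) * 2 ^ v
    ≡⟨ trans (*-comm (2 ^ (k * v)) (2 ^ v)) (sym (^-distribˡ-+-* 2 v (k * v))) ⟩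
  2 ^ (v + k * v) ∎
  where open ≤-Reasoning

-- Positional notation in base `2 ^ v`, lowest digit first: a shift by `v` leaves the packing of the
-- remaining digits, so `r` such shifts bring digit `r` to the low end, where the remainder isolates
-- it.
pack-digit : ∀ v k digits {r} → r < k → (pack v k digits ≫ (r * v)) mod2^ v ≡ toℕ (digits r)
pack-digit v (suc k) digits {zero} _ = begin
  (toℕ (digits 0) + rest * 2 ^ v) / 1 mod2^ v    ≡⟨ cong (_mod2^ v) (n/1≡n (toℕ (digits 0) + rest * 2 ^ v)) ⟩
  (toℕ (digits 0) + rest * 2 ^ v) mod2^ v        ≡⟨ [m+kn]%n≡m%n (toℕ (digits 0)) rest (2 ^ v) {{m^n≢0 2 v}} ⟩
  toℕ (digits 0) mod2^ v                         ≡⟨ <⇒mod2^≡ v (toℕ<n (digits 0)) ⟩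
  toℕ (digits 0)                                 ∎
  where
  open ≡-Reasoning
  rest = pack v k (λ r → digits (suc r))
pack-digit v (suc k) digits {suc r} (s≤s r<k) = begin
  (x ≫ (v + r * v)) mod2^ v                   ≡⟨ cong (_mod2^ v) (/-congʳ (^-distribˡ-+-* 2 v (r * v))) ⟩
  (x / (2 ^ v * 2 ^ (r * v))) mod2^ v         ≡⟨ cong (_mod2^ v) (m/n/o≡m/[n*o] x (2 ^ v) (2 ^ (r * v))) ⟨
  (x ≫ v ≫ (r * v)) mod2^ v                   ≡⟨ cong (λ y → (y ≫ (r * v)) mod2^ v) shift ⟩
  (rest ≫ (r * v)) mod2^ v                    ≡⟨ pack-digit v k (λ r → digits (suc r)) r<k ⟩
  toℕ (digits (suc r))                        ∎
  where
  open ≡-Reasoning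
  rest = pack v k (λ r → digits (suc r))
  x = toℕ (digits 0) + rest * 2 ^ v
  instance
    2^v-nonZero : NonZero (2 ^ v)
    2^v-nonZero = m^n≢0 2 v
    2^rv-nonZero : NonZero (2 ^ (r * v))
    2^rv-nonZero = m^n≢0 2 (r * v)
    2^[v+rv]-nonZero : NonZero (2 ^ (v + r * v))
    2^[v+rv]-nonZero = m^n≢0 2 (v + r * v)
    product-nonZero : NonZero (2 ^ v * 2 ^ (r * v))
    product-nonZero = m*n≢0 (2 ^ v) (2 ^ (r * v))
  shift : x ≫ v ≡ rest
  shift = begin
    x / 2 ^ v                                            ≡⟨ +-distrib-/-∣ʳ (toℕ (digits 0)) (divides-refl rest) ⟩
    toℕ (digits 0) / 2 ^ v + rest * 2 ^ v / 2 ^ v        ≡⟨ cong₂ _+_ (m<n⇒m/n≡0 (toℕ<n (digits 0))) (m*n/n≡m rest (2 ^ v)) ⟩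
    rest                                                 ∎

-- Every positive integer is an odd number times a power of two in exactly one way, so different
-- arrays never collide.
address : ℕ → ℕ → ℕ
address i q = (q + q + 1) * 2 ^ i

-- Serves to define the memory contents and is never executed by a query. The fuel bounds the number
-- of factors 2 removed; without fuel the result is a dummy.
decode : ℕ → ℕ → ℕ × ℕ
decode zero       x = 0 , 0
decode (suc fuel) x = if odd x then (0 , ⌊ x /2⌋) else map₁ suc (decode fuel ⌊ x /2⌋)

odd-double : ∀ x → odd (x + x) ≡ false
odd-double zero    = refl
odd-double (suc x) rewrite +-suc x x = trans (not-involutive _) (odd-double x)

half-double : ∀ x → ⌊ x + x /2⌋ ≡ x
half-double x = sym (n≡⌊n+n/2⌋ x)

half-suc-double : ∀ x → ⌊ suc (x + x) /2⌋ ≡ x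
half-suc-double zero    = refl
half-suc-double (suc x) rewrite +-suc x x = cong suc (half-suc-double x)

*-double : ∀ x y → x * (2 * y) ≡ x * y + x * y
*-double = solve-∀

decode-address : ∀ {fuel} i q → i < fuel → decode fuel (address i q) ≡ (i , q)
decode-address {suc fuel} zero q _
  rewrite *-identityʳ (q + q + 1) | +-comm (q + q) 1 | odd-double q | half-suc-double q = refl
decode-address {suc fuel} (suc i) q (s≤s i<fuel)
  rewrite *-double (q + q + 1) (2 ^ i) | odd-double ((q + q + 1) * 2 ^ i)
        | half-double ((q + q + 1) * 2 ^ i) | decode-address i q i<fuel = refl

module _ {w size} (addressable : size ≤ 2 ^ w) (φ : ℕ → ℕ) where

  storing : DataStructure w
  storing = record
    { size        = size
    ; addressable = addressable
    ; contents    = Vec.tabulate (λ i → wrap w (φ (toℕ i)))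
    }

  -- The bound `fits` is what undoes the `wrap` applied when the cell was written.
  record Stored (x y : ℕ) : Set where
    constructor stored
    field
      in-range : x < size
      value    : φ x ≡ y
      fits     : y < 2 ^ w

  lookup-stored : ∀ {mem} → StoredIn storing mem →
    ∀ u {y} → Stored (toℕ u) y → toℕ (mem u) ≡ y
  lookup-stored {mem} inMem u {y} (stored u<size φu≡y y<2^w) = begin
    toℕ (mem u)                                    ≡⟨ cong (λ v → toℕ (mem v)) u≡ ⟨
    toℕ (mem (inject≤ i addressable))              ≡⟨ cong toℕ (inMem i) ⟩
    toℕ (Vec.lookup (Vec.tabulate (λ i → wrap w (φ (toℕ i)))) i)
                                                   ≡⟨ cong toℕ (lookup∘tabulate (λ i → wrap w (φ (toℕ i))) i) ⟩
    toℕ (wrap w (φ (toℕ i)))                       ≡⟨ cong (λ x → toℕ (wrap w (φ x))) (toℕ-fromℕ< u<size) ⟩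
    toℕ (wrap w (φ (toℕ u)))                       ≡⟨ toℕ-wrap w (φ (toℕ u)) ⟩
    φ (toℕ u) mod2^ w                              ≡⟨ cong (_mod2^ w) φu≡y ⟩
    y mod2^ w                                      ≡⟨ <⇒mod2^≡ w y<2^w ⟩
    y                                              ∎
    where
    open ≡-Reasoning
    i : Fin size
    i = Fin.fromℕ< u<size
    u≡ : inject≤ i addressable ≡ u
    u≡ = Fin.toℕ-injective (trans (Fin.toℕ-inject≤ i addressable) (toℕ-fromℕ< u<size))

  queryRegs-represents : ∀ {a b} → a < 2 ^ w → b < 2 ^ w →
    _Represents_ w Stored (queryRegs w a b) (((λ _ → 0) [ 1 ≔ b ]) [ 0 ≔ a ])
  queryRegs-represents {a} a<2^w b<2^w 0             = trans (toℕ-wrap w a) (<⇒mod2^≡ w a<2^w)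
  queryRegs-represents {b = b} a<2^w b<2^w 1         = trans (toℕ-wrap w b) (<⇒mod2^≡ w b<2^w)
  queryRegs-represents a<2^w b<2^w (suc (suc r))     = trans (toℕ-wrap w 0) (<⇒mod2^≡ w (m^n>0 2 w))

  computes : ∀ {P a b ρ′} → a < 2 ^ w → b < 2 ^ w →
    Trace w Stored P (((λ _ → 0) [ 1 ≔ b ]) [ 0 ≔ a ]) ρ′ →
    Computes P (length P) storing a b (ρ′ 0)
  computes {P} a<2^w b<2^w tr mem inMem
    with σ , halts , σ≈ρ′ , mem≡ ← run-trace w Stored P (lookup-stored inMem) tr 0 _ refl
                                     (queryRegs-represents a<2^w b<2^w)
    = σ , halts , σ≈ρ′ 0 , subst (StoredIn storing) (sym mem≡) inMem

-- Address 7 is the last word in the record of slot 0 and holds `H`, the one parameter required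
-- before a slot is known. Register 6 is the size and register 9 the slot, then the address inside
-- its record of 8 words; registers 10 to 16 receive that record. Registers 17, 18 and 19 are the
-- start, the length and the index of the core, 20 leads to the word containing the answer, and 21
-- to the digit in it.
queryProgram : Program
queryProgram =
  const 2 1      ∷ const 3 8       ∷ const 4 7       ∷ load 5 4         ∷
  op sub 6 1 0   ∷ op add 6 6 2    ∷
  op div 7 6 5   ∷ op lt 8 6 5     ∷ op add 9 6 5    ∷ op mul 9 9 8     ∷ op add 9 9 7 ∷
  op mul 9 9 3   ∷ load 10 9       ∷
  op add 9 9 2   ∷ load 11 9       ∷
  op add 9 9 2   ∷ load 12 9       ∷
  op add 9 9 2   ∷ load 13 9       ∷
  op add 9 9 2   ∷ load 14 9       ∷
  op add 9 9 2   ∷ load 15 9       ∷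
  op add 9 9 2   ∷ load 16 9       ∷
  op add 17 0 10 ∷ op sub 17 17 2  ∷ op div 17 17 10 ∷
  op add 18 1 2  ∷ op div 18 18 10 ∷ op sub 18 18 17 ∷
  op mul 19 17 14 ∷ op add 19 19 18 ∷
  op div 20 19 13 ∷ op mod 21 19 13 ∷
  op add 20 20 20 ∷ op add 20 20 2 ∷ op mul 20 20 11 ∷ op add 20 20 15 ∷ load 22 20 ∷
  op mul 21 21 12 ∷ op shr 22 22 21 ∷ op mod 22 22 16 ∷
  op mul 0 17 10  ∷ op add 0 0 22 ∷ []

module _ {w : ℕ} {Cell : ℕ → ℕ → Set} where
  open Arithmetic w using (_⟨_⟩_⇓_)

  -- Stated for arbitrary intermediate values, so that checking it involves only register numbers;
  -- the actual arithmetic enters in `queryTrace`.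
  query-trace : ∀ {a b H s₀ s y x t₁ t₂ t t₈ g S v k W base B
                  e₁ e a′ b₁ b′ d i₁ i q r q₂ q₃ q₄ z word sh word′ out lo p} →
    8 < 2 ^ w → Cell 7 H →
    b ⟨ sub ⟩ a ⇓ s₀ → s₀ ⟨ add ⟩ 1 ⇓ s →
    s ⟨ div ⟩ H ⇓ y → s ⟨ lt ⟩ H ⇓ x → s ⟨ add ⟩ H ⇓ t₁ → t₁ ⟨ mul ⟩ x ⇓ t₂ → t₂ ⟨ add ⟩ y ⇓ t →
    t ⟨ mul ⟩ 8 ⇓ t₈ → (∀ j → j < 8 → j + t₈ < 2 ^ w) →
    Cell t₈ g → Cell (1 + t₈) S → Cell (2 + t₈) v → Cell (3 + t₈) k → Cell (4 + t₈) W →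
    Cell (5 + t₈) base → Cell (6 + t₈) B →
    a ⟨ add ⟩ g ⇓ e₁ → e₁ ⟨ sub ⟩ 1 ⇓ e → e ⟨ div ⟩ g ⇓ a′ →
    b ⟨ add ⟩ 1 ⇓ b₁ → b₁ ⟨ div ⟩ g ⇓ b′ → b′ ⟨ sub ⟩ a′ ⇓ d →
    a′ ⟨ mul ⟩ W ⇓ i₁ → i₁ ⟨ add ⟩ d ⇓ i → i ⟨ div ⟩ k ⇓ q → i ⟨ mod ⟩ k ⇓ r →
    q ⟨ add ⟩ q ⇓ q₂ → q₂ ⟨ add ⟩ 1 ⇓ q₃ → q₃ ⟨ mul ⟩ S ⇓ q₄ → q₄ ⟨ add ⟩ base ⇓ z → Cell z word →
    r ⟨ mul ⟩ v ⇓ sh → word ⟨ shr ⟩ sh ⇓ word′ → word′ ⟨ mod ⟩ B ⇓ out →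
    a′ ⟨ mul ⟩ g ⇓ lo → lo ⟨ add ⟩ out ⇓ p →
    ∃[ ρ ] Trace w Cell queryProgram (((λ _ → 0) [ 1 ≔ b ]) [ 0 ≔ a ]) ρ × ρ 0 ≡ p
  query-trace {t₈ = t₈} 8< cH s₀ s y x t₁ t₂ t t₈⇓ t₈< cg cS cv ck cW cbase cB
              e₁ e a′ b₁ b′ d i₁ i q r q₂ q₃ q₄ z cz sh word′ out lo p =
    _ , (const (≤-<-trans (s≤s z≤n) 8<) $′ const 8< $′ const (≤-<-trans (n≤1+n 7) 8<) $′ load cH $′
    op s₀ $′ op s $′ op y $′ op x $′ op t₁ $′ op t₂ $′ op t $′ op t₈⇓ $′ load cg $′
    op (next 0 (s≤s z≤n)) $′ load cS $′
    op (next 1 (s≤s (s≤s z≤n))) $′ load cv $′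
    op (next 2 (s≤s (s≤s (s≤s z≤n)))) $′ load ck $′
    op (next 3 (s≤s (s≤s (s≤s (s≤s z≤n))))) $′ load cW $′
    op (next 4 (s≤s (s≤s (s≤s (s≤s (s≤s z≤n)))))) $′ load cbase $′
    op (next 5 (s≤s (s≤s (s≤s (s≤s (s≤s (s≤s z≤n))))))) $′ load cB $′
    op e₁ $′ op e $′ op a′ $′ op b₁ $′ op b′ $′ op d $′ op i₁ $′ op i $′ op q $′ op r $′
    op q₂ $′ op q₃ $′ op q₄ $′ op z $′ load cz $′
    op sh $′ op word′ $′ op out $′ op lo $′ op p done) , refl
    where
    next : ∀ j → j < 7 → (j + t₈) ⟨ add ⟩ 1 ⇓ suc (j + t₈)
    next j j<7 = trans (cong (_mod2^ w) (+-comm (j + t₈) 1)) (<⇒mod2^≡ w (t₈< (suc j) (s≤s j<7)))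

-- The data structure

-- `2 ^ width i` is `8 * 4 ^ i`, which exceeds every size treated at level `i` and hence every
-- offset.
width : ℕ → ℕ
width i = 3 + (i + i)

-- One of the two factors 2^i in 4^i pays for the linear growth of the width; the other is left for
-- the spacing of the addresses.
width≤3*2^ : ∀ i → width i ≤ 3 * 2 ^ i
width≤3*2^ zero    = ≤-refl
width≤3*2^ (suc i) = begin
  3 + (suc i + suc i)                ≡⟨ cong (λ k → 3 + suc k) (+-suc i i) ⟩
  2 + (3 + (i + i))                  ≤⟨ +-mono-≤ (≤-trans (s≤s (s≤s z≤n)) (m≤m*n 3 (2 ^ i) {{m^n≢0 2 i}})) (width≤3*2^ i) ⟩
  3 * 2 ^ i + 3 * 2 ^ i              ≡⟨ *-double 3 (2 ^ i) ⟨
  3 * (2 * 2 ^ i)                    ∎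
  where open ≤-Reasoning

-- The selection is an arbitrary function here: all that the layout requires of it is that an offset
-- is smaller than the core.
module Layout (n L m w : ℕ) {{m≢0 : NonZero m}} {{w≢0 : NonZero w}} (sel : ℕ → ℕ → ℕ) where

  open Arithmetic w

  -- `base` provides 8 words for each of the `2 H` slots. An address `(2 q + 1) * 2 ^ i` splits into
  -- `2 ^ i`, which is below `H`, and `2 q * 2 ^ i`, for which `address-bits` justifies the
  -- quotient.
  Z H blockWidth base size : ℕ
  Z = 2 ^ L
  H = 2 ^ ⌈ L /2⌉
  blockWidth = 16 * m
  base = 16 * H
  size = base + (H + 1 + 1152 * (n * (m * m)) / w)

  instance
    H≢0 : NonZero H
    H≢0 = m^n≢0 2 ⌈ L /2⌉
    blockWidth≢0 : NonZero blockWidth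
    blockWidth≢0 = m*n≢0 16 m

  -- Rounding to multiples of the grid loses at most one less than the grid, so the margin is fixed
  -- first and the grid is its successor. This also keeps the grid positive at low levels, where
  -- `4 ^ i < 2 m`.
  margin grid perWord : ℕ → ℕ
  margin i  = _/_ (2 ^ i * 2 ^ i) (2 * m) {{m*n≢0 2 m}}
  grid i    = suc (margin i)
  perWord i = w / width i

  level : ℕ → ℕ
  level t = ⌊ ⌊log₂ coarse H t ⌋ /2⌋

  answer : ℕ → ℕ → ℕ
  answer i idx = sel (idx / blockWidth * grid i) (idx % blockWidth * grid i)

  -- Entries 4, 5 and 7 agree in all slots. They are stored because they depend on `n` or α and so
  -- cannot be constants of the program.
  parameter : ℕ → ℕ → ℕ
  parameter t 0 = grid (level t)
  parameter t 1 = 2 ^ level t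
  parameter t 2 = width (level t)
  parameter t 3 = perWord (level t)
  parameter t 4 = blockWidth
  parameter t 5 = base
  parameter t 6 = 2 ^ width (level t)
  parameter t _ = H

  answerWord : ℕ × ℕ → ℕ
  answerWord (i , q) = pack (width i) (perWord i) (λ r → wrap (width i) (answer i (q * perWord i + r)))

  cell : ℕ → ℕ
  -- The relative address is enough fuel for decoding itself, because `i < 2 ^ i ≤ address i q`.
  cell x = if x <ᵇ base then parameter (x / 8) (x % 8) else answerWord (decode (x ∸ base) (x ∸ base))

  cell-parameter : ∀ t k → k < 8 → k + t * 8 < base → cell (k + t * 8) ≡ parameter t k
  cell-parameter t k k<8 x<base with k + t * 8 <ᵇ base in lt′
  ... | false = contradiction (subst T lt′ (<⇒<ᵇ x<base)) λ()
  ... | true  = cong₂ parameter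
    (trans (+-distrib-/-∣ʳ k (divides-refl t)) (cong₂ _+_ (m<n⇒m/n≡0 k<8) (m*n/n≡m t 8)))
    (trans ([m+kn]%n≡m%n k t 8) (m<n⇒m%n≡m k<8))

  cell-answers : ∀ i q → cell (address i q + base) ≡ answerWord (i , q)
  cell-answers i q with address i q + base <ᵇ base in lt′
  ... | true  = contradiction (<ᵇ⇒< (address i q + base) base (subst T (sym lt′) _)) (≤⇒≯ (m≤n+m base (address i q)))
  ... | false rewrite m+n∸n≡m (address i q) base = cong answerWord (decode-address i q i<address)
    where
    i<address : i < address i q
    i<address = <-≤-trans (n<2^n i) (m≤n*m (2 ^ i) (q + q + 1) {{>-nonZero (m≤n+m 1 (q + q))}})

  module _ (1≤n : 1 ≤ n) (n<Z : n < Z) (Z≤2n : Z ≤ 2 * n) (2≤m : 2 ≤ m) (m≤Z : m ≤ Z)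
           (14L≤w : 14 * L ≤ w) where

    1≤L : 1 ≤ L
    1≤L = n≢0⇒n>0 λ { refl → <⇒≱ n<Z 1≤n }

    1≤Z : 1 ≤ Z
    1≤Z = m^n>0 2 L

    H≤Z : H ≤ Z
    H≤Z = ^-monoʳ-≤ 2 (⌈n/2⌉≤n L)

    Z≤H² : Z ≤ H * H
    Z≤H² = begin
      2 ^ L                          ≡⟨ cong (2 ^_) (⌊n/2⌋+⌈n/2⌉≡n L) ⟨
      2 ^ (⌊ L /2⌋ + ⌈ L /2⌉)        ≤⟨ ^-monoʳ-≤ 2 (+-monoˡ-≤ ⌈ L /2⌉ (⌊n/2⌋≤⌈n/2⌉ L)) ⟩
      2 ^ (⌈ L /2⌉ + ⌈ L /2⌉)        ≡⟨ 2^[i+i] ⌈ L /2⌉ ⟩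
      H * H                          ∎
      where open ≤-Reasoning

    H²≤4n : H * H ≤ 4 * n
    H²≤4n = begin
      H * H                          ≡⟨ 2^[i+i] ⌈ L /2⌉ ⟨
      2 ^ (⌈ L /2⌉ + ⌈ L /2⌉)        ≡⟨ cong (2 ^_) (cong (⌈ L /2⌉ +_) (+-identityʳ ⌈ L /2⌉)) ⟨
      2 ^ (2 * ⌈ L /2⌉)              ≤⟨ ^-monoʳ-≤ 2 (2*⌊n/2⌋≤n (suc L)) ⟩
      2 * Z                          ≤⟨ *-monoʳ-≤ 2 Z≤2n ⟩
      2 * (2 * n)                    ≡⟨ *-assoc 2 2 n ⟨
      4 * n                          ∎
      where open ≤-Reasoning

    L≤2H : L ≤ 2 * H
    L≤2H = begin
      L                              ≡⟨ ⌊n/2⌋+⌈n/2⌉≡n L ⟨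
      ⌊ L /2⌋ + ⌈ L /2⌉              ≤⟨ +-monoˡ-≤ ⌈ L /2⌉ (⌊n/2⌋≤⌈n/2⌉ L) ⟩
      ⌈ L /2⌉ + ⌈ L /2⌉              ≡⟨ cong (⌈ L /2⌉ +_) (+-identityʳ ⌈ L /2⌉) ⟨
      2 * ⌈ L /2⌉                    ≤⟨ *-monoʳ-≤ 2 (<⇒≤ (n<2^n ⌈ L /2⌉)) ⟩
      2 * H                          ∎
      where open ≤-Reasoning

    n<H² : n < H * H
    n<H² = <-≤-trans n<Z Z≤H²

    Z³ : ℕ
    Z³ = Z * (Z * Z)

    Z≤Z³ : Z ≤ Z³
    Z≤Z³ = m≤m*n Z (Z * Z) {{m*n≢0 Z Z {{>-nonZero 1≤Z}} {{>-nonZero 1≤Z}}}}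

    -- The origin of 14: the left side is 2^(11 + 3 L), and `1 ≤ L` allows 11 to be replaced by
    -- `11 * L`.
    2048Z³≤2^w : 2048 * Z³ ≤ 2 ^ w
    2048Z³≤2^w = begin
      2048 * (Z * (Z * Z))            ≡⟨ cong (λ k → 2048 * (Z * k)) (^-distribˡ-+-* 2 L L) ⟨
      2048 * (Z * 2 ^ (L + L))        ≡⟨ cong (2048 *_) (^-distribˡ-+-* 2 L (L + L)) ⟨
      2 ^ 11 * 2 ^ (L + (L + L))      ≡⟨ ^-distribˡ-+-* 2 11 (L + (L + L)) ⟨
      2 ^ (11 + (L + (L + L)))        ≤⟨ ^-monoʳ-≤ 2 (+-monoˡ-≤ (L + (L + L)) (m≤m*n 11 L {{>-nonZero 1≤L}})) ⟩
      2 ^ (11 * L + (L + (L + L)))    ≡⟨ cong (2 ^_) (collect L) ⟩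
      2 ^ (14 * L)                    ≤⟨ ^-monoʳ-≤ 2 14L≤w ⟩
      2 ^ w                           ∎
      where
      open ≤-Reasoning
      collect : ∀ L → 11 * L + (L + (L + L)) ≡ 14 * L
      collect = solve-∀

    nmm≤Z³ : n * (m * m) ≤ Z³
    nmm≤Z³ = *-mono-≤ (<⇒≤ n<Z) (*-mono-≤ m≤Z m≤Z)

    -- The dominant term `n * (m * m)` is below `Z³` because `m ≤ Z`; this is where the cap on the
    -- precision makes the structure addressable.
    size≤1171Z³ : size ≤ 1171 * Z³
    size≤1171Z³ = begin
      16 * H + (H + 1 + 1152 * (n * (m * m)) / w)
        ≤⟨ +-mono-≤ (*-monoʳ-≤ 16 H≤Z³) (+-mono-≤ (+-mono-≤ H≤Z³ (≤-trans 1≤Z Z≤Z³))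
             (≤-trans (m/n≤m (1152 * (n * (m * m))) w) (*-monoʳ-≤ 1152 nmm≤Z³))) ⟩
      16 * Z³ + (Z³ + Z³ + 1152 * Z³)
        ≡⟨ collect Z³ ⟩
      1170 * Z³
        ≤⟨ *-monoˡ-≤ Z³ (n≤1+n 1170) ⟩
      1171 * Z³ ∎
      where
      open ≤-Reasoning
      H≤Z³ : H ≤ Z³
      H≤Z³ = ≤-trans H≤Z Z≤Z³
      collect : ∀ z → 16 * z + (z + z + 1152 * z) ≡ 1170 * z
      collect = solve-∀

    ≤1171Z³⇒<2^w : ∀ {x} → x ≤ 1171 * Z³ → x < 2 ^ w
    ≤1171Z³⇒<2^w {x} x≤ = begin-strict
      x           ≤⟨ x≤ ⟩
      1171 * Z³   <⟨ *-monoˡ-< Z³ {{>-nonZero (≤-trans 1≤Z Z≤Z³)}} {1171} {2048} (≤ᵇ⇒≤ 1172 2048 _) ⟩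
      2048 * Z³   ≤⟨ 2048Z³≤2^w ⟩
      2 ^ w       ∎
      where open ≤-Reasoning

    addressable : size ≤ 2 ^ w
    addressable = <⇒≤ (≤1171Z³⇒<2^w size≤1171Z³)

    -- The words outside the quotient number O(H) with O(L) bits each; the crude `L ≤ 2 H` turns
    -- this into O(H²), which is O(n). The 144 is 18 · 2 · 4.
    bits≤ : ∀ d → w ≤ d * L → size * w ≤ (144 * d + 1152) * n * (m * m)
    bits≤ d w≤dL = begin
      (16 * H + (H + 1 + X / w)) * w                       ≡⟨ expand H (X / w) w ⟩
      (17 * H + 1) * w + X / w * w                         ≤⟨ +-mono-≤ (*-mono-≤ (+-monoʳ-≤ (17 * H) (m^n>0 2 ⌈ L /2⌉)) w≤dL) (m/n*n≤m X w) ⟩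
      (17 * H + H) * (d * L) + X                           ≤⟨ +-monoˡ-≤ X (*-monoʳ-≤ (17 * H + H) (*-monoʳ-≤ d L≤2H)) ⟩
      (17 * H + H) * (d * (2 * H)) + X                     ≡⟨ cong (_+ X) (regroup H d) ⟩
      36 * d * (H * H) + X                                 ≤⟨ +-monoˡ-≤ X (*-monoʳ-≤ (36 * d) H²≤4n) ⟩
      36 * d * (4 * n) + X                                 ≡⟨ cong (_+ X) (regroup′ d n) ⟩
      144 * d * n + X                                      ≤⟨ +-monoˡ-≤ X (m≤m*n (144 * d * n) (m * m) {{m*n≢0 m m}}) ⟩
      144 * d * n * (m * m) + X                            ≡⟨ factor d n (m * m) ⟩
      (144 * d + 1152) * n * (m * m)                       ∎
      where
      open ≤-Reasoning
      X = 1152 * (n * (m * m))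
      expand : ∀ H y w → (16 * H + (H + 1 + y)) * w ≡ (17 * H + 1) * w + y * w
      expand = solve-∀
      regroup : ∀ H d → (17 * H + H) * (d * (2 * H)) ≡ 36 * d * (H * H)
      regroup = solve-∀
      regroup′ : ∀ d n → 36 * d * (4 * n) ≡ 144 * d * n
      regroup′ = solve-∀
      factor : ∀ d n k → 144 * d * n * k + 1152 * (n * k) ≡ (144 * d + 1152) * n * k
      factor = solve-∀

    module _ (sel-< : ∀ {lo len} → 1 ≤ len → lo + len ≤ n → sel lo len < len)
             {a b : ℕ} (a≤b : a ≤ b) (b<n : b < n) where

      private
        M = 2 ^ w
        s = suc (b ∸ a)
        t = slot H s
        i = level t
        S = 2 ^ i
        v = width i
        g = grid i
        γ = margin i

        instance
          2m≢0 : NonZero (2 * m)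
          2m≢0 = m*n≢0 2 m

        s≤n : s ≤ n
        s≤n = ≤-trans (s≤s (m∸n≤m b a)) b<n

        slot-facts : 1 ≤ coarse H t × coarse H t ≤ s × s < 2 * coarse H t × t < 2 * H
        slot-facts = coarse-slot H (s≤s z≤n) (≤-<-trans s≤n n<H²)

        1≤coarse = proj₁ slot-facts
        t<2H = proj₂ (proj₂ (proj₂ slot-facts))

        S²≤s : S * S ≤ s
        S²≤s = ≤-trans (4^level≤ (coarse H t) 1≤coarse) (proj₁ (proj₂ slot-facts))

        S²≤n : S * S ≤ n
        S²≤n = ≤-trans S²≤s s≤n

        s<8S² : s < 8 * (S * S)
        s<8S² = begin-strict
          s                       <⟨ proj₁ (proj₂ (proj₂ slot-facts)) ⟩
          2 * coarse H t          ≤⟨ *-monoʳ-≤ 2 (<⇒≤ (<4*4^level (coarse H t) 1≤coarse)) ⟩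
          2 * (4 * (S * S))       ≡⟨ *-assoc 2 4 (S * S) ⟨
          8 * (S * S)             ∎
          where open ≤-Reasoning

        2^v≡8S² : 2 ^ v ≡ 8 * (S * S)
        2^v≡8S² = trans (^-distribˡ-+-* 2 3 (i + i)) (cong (8 *_) (2^[i+i] i))

        S<H : S < H
        S<H = ≰⇒> λ H≤S → <⇒≱ n<H² (≤-trans (*-mono-≤ H≤S H≤S) S²≤n)

        v<w : v < w
        v<w = begin-strict
          3 + (i + i)             <⟨ +-monoʳ-< 3 i+i<L ⟩
          3 + L                   ≤⟨ +-monoˡ-≤ L (*-monoʳ-≤ 3 1≤L) ⟩
          3 * L + L               ≡⟨ +-comm (3 * L) L ⟩
          4 * L                   ≤⟨ *-monoˡ-≤ L (≤ᵇ⇒≤ 4 14 _) ⟩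
          14 * L                  ≤⟨ 14L≤w ⟩
          w                       ∎
          where
          open ≤-Reasoning
          i+i<L : i + i < L
          i+i<L = ≰⇒> λ L≤i+i →
            <⇒≱ (≤-<-trans (subst (_≤ n) (sym (2^[i+i] i)) S²≤n) n<Z) (^-monoʳ-≤ 2 L≤i+i)

        instance
          perWord≢0 : NonZero (perWord i)
          perWord≢0 = >-nonZero (m≥n⇒m/n>0 (<⇒≤ v<w))

        S²<2mg : S * S < g * (2 * m)
        S²<2mg = m<[1+m/n]*n (S * S) (2 * m)

        γ2m≤S² : γ * (2 * m) ≤ S * S
        γ2m≤S² = m/n*n≤m (S * S) (2 * m)

        γ≤n : γ ≤ n
        γ≤n = ≤-trans (m≤m*n γ (2 * m)) (≤-trans γ2m≤S² S²≤n)

        open Core {γ = γ} a≤b 2≤m γ2m≤S² S²≤s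
          renaming (coreStart to a′; coreEnd to b′; coreCells to d)

        lo = a′ * g
        len = d * g

        b+1≤n : b + 1 ≤ n
        b+1≤n = subst (_≤ n) (+-comm 1 b) b<n

        lo+len≤n : lo + len ≤ n
        lo+len≤n = subst (_≤ n) (sym core-end) (≤-trans coreEnd≤ b+1≤n)

        lo≤n : lo ≤ n
        lo≤n = ≤-trans (m≤m+n lo len) lo+len≤n

        -- The origin of 16: the size is below `8 * 4 ^ i`, and `4 ^ i < 2 m g`.
        d<blockWidth : d < blockWidth
        d<blockWidth = *-cancelʳ-< g d blockWidth (begin-strict
          d * g                   ≤⟨ coreLength≤ ⟩
          s                       <⟨ s<8S² ⟩
          8 * (S * S)             ≤⟨ *-monoʳ-≤ 8 (<⇒≤ S²<2mg) ⟩
          8 * (g * (2 * m))       ≡⟨ regroup g m ⟩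
          16 * m * g              ∎)
          where
          open ≤-Reasoning
          regroup : ∀ g m → 8 * (g * (2 * m)) ≡ 16 * m * g
          regroup = solve-∀

        idx = a′ * blockWidth + d
        q = idx / perWord i
        r = idx % perWord i
        word = answerWord (i , q)

        idx-/ : idx / blockWidth ≡ a′
        idx-/ = trans (cong (_/ blockWidth) (+-comm (a′ * blockWidth) d))
          (trans (+-distrib-/-∣ʳ d (divides-refl a′)) (cong₂ _+_ (m<n⇒m/n≡0 d<blockWidth) (m*n/n≡m a′ blockWidth)))

        idx-% : idx % blockWidth ≡ d
        idx-% = trans (cong (_% blockWidth) (+-comm (a′ * blockWidth) d))
          (trans ([m+kn]%n≡m%n d a′ blockWidth) (m<n⇒m%n≡m d<blockWidth))

        answer-idx : answer i idx ≡ sel lo len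
        answer-idx = cong₂ (λ x y → sel (x * g) (y * g)) idx-/ idx-%

        sel<2^v : sel lo len < 2 ^ v
        sel<2^v = begin-strict
          sel lo len              <⟨ sel-< 1≤coreLength lo+len≤n ⟩
          len                     ≤⟨ coreLength≤ ⟩
          s                       ≤⟨ <⇒≤ s<8S² ⟩
          8 * (S * S)             ≡⟨ 2^v≡8S² ⟨
          2 ^ v                   ∎
          where open ≤-Reasoning

        word-digit : (word ≫ (r * v)) mod2^ v ≡ sel lo len
        word-digit = begin
          (word ≫ (r * v)) mod2^ v
            ≡⟨ pack-digit v (perWord i) (λ r → wrap v (answer i (q * perWord i + r))) (m%n<n idx (perWord i)) ⟩
          toℕ (wrap v (answer i (q * perWord i + r)))      ≡⟨ toℕ-wrap v (answer i (q * perWord i + r)) ⟩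
          answer i (q * perWord i + r) mod2^ v
            ≡⟨ cong (λ k → answer i k mod2^ v)
                 (trans (+-comm (q * perWord i) r) (sym (m≡m%n+[m/n]*n idx (perWord i)))) ⟩
          answer i idx mod2^ v                             ≡⟨ cong (_mod2^ v) answer-idx ⟩
          sel lo len mod2^ v                               ≡⟨ <⇒mod2^≡ v sel<2^v ⟩
          sel lo len                                       ∎
          where open ≡-Reasoning

        -- The index is at most `16 m` times `a′ + 1`, and `(a′ + 1) * g ≤ 3 n` since the grid may
        -- be as large as `1 + n`, which is at most `2 n`.
        idx*g≤48nm : idx * g ≤ 48 * (n * m)
        idx*g≤48nm = begin
          (a′ * blockWidth + d) * g             ≤⟨ *-monoˡ-≤ g (+-monoʳ-≤ (a′ * blockWidth) (<⇒≤ d<blockWidth)) ⟩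
          (a′ * (16 * m) + 16 * m) * g          ≡⟨ regroup a′ m g ⟩
          (a′ * g + g) * (16 * m)               ≤⟨ *-monoˡ-≤ (16 * m) (+-mono-≤ lo≤n (+-mono-≤ 1≤n γ≤n)) ⟩
          (n + (n + n)) * (16 * m)              ≡⟨ collect n m ⟩
          48 * (n * m)                          ∎
          where
          open ≤-Reasoning
          regroup : ∀ a m g → (a * (16 * m) + 16 * m) * g ≡ (a * g + g) * (16 * m)
          regroup = solve-∀
          collect : ∀ n m → (n + (n + n)) * (16 * m) ≡ 48 * (n * m)
          collect = solve-∀

        w≤2*perWord*v : w ≤ 2 * (perWord i * v)
        w≤2*perWord*v = begin
          w                                 ≤⟨ <⇒≤ (m<[1+m/n]*n w v) ⟩
          v + perWord i * v                 ≤⟨ +-monoˡ-≤ (perWord i * v) (m≤n*m v (perWord i)) ⟩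
          perWord i * v + perWord i * v     ≡⟨ cong (perWord i * v +_) (+-identityʳ (perWord i * v)) ⟨
          2 * (perWord i * v)               ∎
          where open ≤-Reasoning

        -- How far array `i` reaches in memory, in bits, bounded independently of `i`: a common
        -- reach takes the place of a sum over levels. The width times the spacing `2 ^ i` is at
        -- most `3 * 4 ^ i`, and `4 ^ i < 2 m g` turns the index into `idx * g`, where the grid
        -- cancels the number of starts. The constant is 24 · 48.
        address-bits : (q + q) * S * w ≤ 1152 * (n * (m * m))
        address-bits = begin
          (q + q) * S * w                                 ≤⟨ *-monoʳ-≤ ((q + q) * S) w≤2*perWord*v ⟩
          (q + q) * S * (2 * (perWord i * v))             ≡⟨ regroup q S (perWord i) v ⟩
          4 * (q * perWord i) * (v * S)                   ≤⟨ *-mono-≤ (*-monoʳ-≤ 4 (m/n*n≤m idx (perWord i))) (*-monoˡ-≤ S (width≤3*2^ i)) ⟩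
          4 * idx * (3 * S * S)                           ≡⟨ regroup′ idx S ⟩
          12 * idx * (S * S)                              ≤⟨ *-monoʳ-≤ (12 * idx) (<⇒≤ S²<2mg) ⟩
          12 * idx * (g * (2 * m))                        ≡⟨ regroup″ idx g m ⟩
          24 * m * (idx * g)                              ≤⟨ *-monoʳ-≤ (24 * m) idx*g≤48nm ⟩
          24 * m * (48 * (n * m))                         ≡⟨ collect n m ⟩
          1152 * (n * (m * m))                            ∎
          where
          open ≤-Reasoning
          regroup : ∀ q S p v → (q + q) * S * (2 * (p * v)) ≡ 4 * (q * p) * (v * S)
          regroup = solve-∀
          regroup′ : ∀ k S → 4 * k * (3 * S * S) ≡ 12 * k * (S * S)
          regroup′ = solve-∀
          regroup″ : ∀ k g m → 12 * k * (g * (2 * m)) ≡ 24 * m * (k * g)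
          regroup″ = solve-∀
          collect : ∀ n m → 24 * m * (48 * (n * m)) ≡ 1152 * (n * (m * m))
          collect = solve-∀

        address<size : address i q + base < size
        address<size = begin-strict
          address i q + base                                          ≡⟨ +-comm (address i q) base ⟩
          base + (q + q + 1) * S                                      ≡⟨ cong (base +_) (expand (q + q) S) ⟩
          base + (S + (q + q) * S)                                    <⟨ +-monoʳ-< base (+-mono-<-≤
              (<-≤-trans S<H (m≤m+n H 1)) (m*n≤o⇒m≤o/n ((q + q) * S) w (1152 * (n * (m * m))) address-bits)) ⟩
          size                                                        ∎
          where
          open ≤-Reasoning
          expand : ∀ x S → (x + 1) * S ≡ S + x * S
          expand = solve-∀

        fits : ∀ k {x} → {T (k ≤ᵇ 1171)} → x ≤ k * Z³ → x < M
        fits k {x} {k≤} x≤ = ≤1171Z³⇒<2^w (≤-trans x≤ (*-monoˡ-≤ Z³ (≤ᵇ⇒≤ k 1171 k≤)))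

        fitsZ : ∀ k {x} → {T (k ≤ᵇ 1171)} → x ≤ k * Z → x < M
        fitsZ k {x} {k≤} x≤ = fits k {x} {k≤} (≤-trans x≤ (*-monoʳ-≤ k Z≤Z³))

        <size⇒fits : ∀ {x} → x < size → x < M
        <size⇒fits x<size = <-≤-trans x<size addressable

        ≤n⇒fits : ∀ {x} → x ≤ n → x < M
        ≤n⇒fits {x} x≤n = fitsZ 1 (≤-trans x≤n (≤-trans (<⇒≤ n<Z) (m≤m+n Z 0)))

        ≤w⇒fits : ∀ {x} → x ≤ w → x < M
        ≤w⇒fits x≤w = ≤-<-trans x≤w (n<2^n w)

        nm≤Z³ : n * m ≤ Z³
        nm≤Z³ = ≤-trans (*-monoʳ-≤ n (m≤m*n m m)) nmm≤Z³

        idx≤48Z³ : idx ≤ 48 * Z³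
        idx≤48Z³ = ≤-trans (m≤m*n idx g) (≤-trans idx*g≤48nm (*-monoʳ-≤ 48 nm≤Z³))

        parameter-address<base : ∀ k → k < 8 → k + t * 8 < base
        parameter-address<base k k<8 = begin-strict
          k + t * 8          <⟨ +-monoˡ-< (t * 8) k<8 ⟩
          suc t * 8          ≤⟨ *-monoˡ-≤ 8 t<2H ⟩
          2 * H * 8          ≡⟨ collect H ⟩
          16 * H             ∎
          where
          open ≤-Reasoning
          collect : ∀ H → 2 * H * 8 ≡ 16 * H
          collect = solve-∀

        Cell : ℕ → ℕ → Set
        Cell = Stored {w} {size} addressable cell

        parameter-cell : ∀ k → k < 8 → parameter t k < M → Cell (k + t * 8) (parameter t k)
        parameter-cell k k<8 = stored (<-≤-trans (parameter-address<base k k<8) (m≤m+n base _))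
                                      (cell-parameter t k k<8 (parameter-address<base k k<8))

        H<M : H < M
        H<M = fitsZ 1 (≤-trans H≤Z (m≤m+n Z 0))

        H-cell : Cell 7 H
        H-cell = stored (<-≤-trans 7<base (m≤m+n base _)) (cell-parameter 0 7 ≤-refl 7<base) H<M
          where
          7<base : 7 < base
          7<base = ≤-trans (≤ᵇ⇒≤ 8 16 _) (m≤m*n 16 H)

        s+H≤2Z : s + H ≤ 2 * Z
        s+H≤2Z = ≤-trans (+-mono-≤ (≤-trans s≤n (<⇒≤ n<Z)) H≤Z) (≤-reflexive (cong (Z +_) (sym (+-identityʳ Z))))

        fromBool≤1 : ∀ x → fromBool x ≤ 1
        fromBool≤1 true  = ≤-refl
        fromBool≤1 false = z≤n

        word<M : word < M
        word<M = <-≤-trans (pack-< v (perWord i) (λ r → wrap v (answer i (q * perWord i + r)))) (^-monoʳ-≤ 2 (m/n*n≤m w v))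

        a+g≤3Z : a + g ≤ 3 * Z
        a+g≤3Z = begin
          a + suc γ          ≤⟨ +-mono-≤ (≤-trans a≤b (<⇒≤ b<n)) (+-mono-≤ 1≤n γ≤n) ⟩
          n + (n + n)        ≡⟨ collect n ⟩
          3 * n              ≤⟨ *-monoʳ-≤ 3 (<⇒≤ n<Z) ⟩
          3 * Z              ∎
          where
          open ≤-Reasoning
          collect : ∀ n → n + (n + n) ≡ 3 * n
          collect = solve-∀

        sum⇓ : (b ∸ a) ⟨ add ⟩ 1 ⇓ s
        sum⇓ = subst (λ k → (b ∸ a) ⟨ add ⟩ 1 ⇓ k) (+-comm (b ∸ a) 1)
          (⇓add (b ∸ a) 1 (≤n⇒fits (subst (_≤ n) (+-comm 1 (b ∸ a)) s≤n)))

        t₁⇓ : s ⟨ add ⟩ H ⇓ (s + H)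
        t₁⇓ = ⇓add s H (fitsZ 2 s+H≤2Z)

        t₂⇓ : (s + H) ⟨ mul ⟩ fromBool (s <ᵇ H) ⇓ ((s + H) * fromBool (s <ᵇ H))
        t₂⇓ = ⇓mul (s + H) (fromBool (s <ᵇ H)) (fitsZ 2 (≤-trans
          (≤-trans (*-monoʳ-≤ (s + H) (fromBool≤1 (s <ᵇ H))) (≤-reflexive (*-identityʳ (s + H)))) s+H≤2Z))

        t⇓ : ((s + H) * fromBool (s <ᵇ H)) ⟨ add ⟩ (s / H) ⇓ t
        t⇓ = ⇓add ((s + H) * fromBool (s <ᵇ H)) (s / H) (<-trans t<2H (fitsZ 2 (*-monoʳ-≤ 2 H≤Z)))

        parameter-address-fits : ∀ j → j < 8 → j + t * 8 < M
        parameter-address-fits j j<8 = <size⇒fits (<-≤-trans (parameter-address<base j j<8) (m≤m+n base _))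

        a+g<M : a + g < M
        a+g<M = fitsZ 3 a+g≤3Z
        idx<M : idx < M
        idx<M = fits 48 idx≤48Z³
        q₃<M : q + q + 1 < M
        q₃<M = <size⇒fits (≤-<-trans (≤-trans (m≤m*n (q + q + 1) S {{m^n≢0 2 i}}) (m≤m+n (address i q) base)) address<size)

        e⇓ : (a + g) ⟨ sub ⟩ 1 ⇓ (a + γ)
        e⇓ = subst (λ k → (a + g) ⟨ sub ⟩ 1 ⇓ k) (cong (_∸ 1) (+-suc a γ))
            (⇓sub (a + g) 1 (≤-trans (s≤s z≤n) (m≤n+m g a)) a+g<M)

        out⇓ : (word ≫ (r * v)) ⟨ mod ⟩ (2 ^ v) ⇓ sel lo len
        out⇓ = subst (λ k → (word ≫ (r * v)) ⟨ mod ⟩ (2 ^ v) ⇓ k) word-digit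
            (⇓mod (word ≫ (r * v)) (2 ^ v) {{m^n≢0 2 v}} (≤-<-trans (m/n≤m word (2 ^ (r * v)) {{m^n≢0 2 (r * v)}}) word<M))

        sh⇓ : r ⟨ mul ⟩ v ⇓ (r * v)
        sh⇓ = ⇓mul r v (≤w⇒fits (≤-trans (*-monoˡ-≤ v (<⇒≤ (m%n<n idx (perWord i)))) (m/n*n≤m w v)))

        p⇓ : lo ⟨ add ⟩ sel lo len ⇓ (lo + sel lo len)
        p⇓ = ⇓add lo (sel lo len) (≤n⇒fits (≤-trans (+-monoʳ-≤ lo (<⇒≤ (sel-< 1≤coreLength lo+len≤n))) lo+len≤n))

        a′⇓ : (a + γ) ⟨ div ⟩ g ⇓ a′
        a′⇓ = ⇓div (a + γ) g (≤-<-trans (+-monoʳ-≤ a (n≤1+n γ)) a+g<M)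

        b′⇓ : (b + 1) ⟨ div ⟩ g ⇓ b′
        b′⇓ = ⇓div (b + 1) g (≤n⇒fits b+1≤n)

        d⇓ : b′ ⟨ sub ⟩ a′ ⇓ d
        d⇓ = ⇓sub b′ a′ (<⇒≤ coreStart<coreEnd) (≤n⇒fits (≤-trans (m/n≤m (b + 1) g) b+1≤n))

        i₁⇓ : a′ ⟨ mul ⟩ blockWidth ⇓ (a′ * blockWidth)
        i₁⇓ = ⇓mul a′ blockWidth (≤-<-trans (m≤m+n (a′ * blockWidth) d) idx<M)

        idx⇓ : (a′ * blockWidth) ⟨ add ⟩ d ⇓ idx
        idx⇓ = ⇓add (a′ * blockWidth) d idx<M

        q⇓ : idx ⟨ div ⟩ perWord i ⇓ q
        q⇓ = ⇓div idx (perWord i) idx<M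

        r⇓ : idx ⟨ mod ⟩ perWord i ⇓ r
        r⇓ = ⇓mod idx (perWord i) idx<M

        q₂⇓ : q ⟨ add ⟩ q ⇓ (q + q)
        q₂⇓ = ⇓add q q (≤-<-trans (m≤m+n (q + q) 1) q₃<M)

        q₃⇓ : (q + q) ⟨ add ⟩ 1 ⇓ (q + q + 1)
        q₃⇓ = ⇓add (q + q) 1 q₃<M

        q₄⇓ : (q + q + 1) ⟨ mul ⟩ S ⇓ address i q
        q₄⇓ = ⇓mul (q + q + 1) S (<size⇒fits (≤-<-trans (m≤m+n (address i q) base) address<size))

        z⇓ : address i q ⟨ add ⟩ base ⇓ (address i q + base)
        z⇓ = ⇓add (address i q) base (<size⇒fits address<size)

        z-cell : Cell (address i q + base) word
        z-cell = stored address<size (cell-answers i q) word<M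

        g-cell : Cell (t * 8) g
        g-cell = parameter-cell 0 (≤ᵇ⇒≤ 1 8 _) (≤-<-trans (m≤n+m g a) a+g<M)
        S-cell : Cell (1 + t * 8) S
        S-cell = parameter-cell 1 (≤ᵇ⇒≤ 2 8 _) (<-trans S<H H<M)
        v-cell : Cell (2 + t * 8) v
        v-cell = parameter-cell 2 (≤ᵇ⇒≤ 3 8 _) (≤w⇒fits (<⇒≤ v<w))
        perWord-cell : Cell (3 + t * 8) (perWord i)
        perWord-cell = parameter-cell 3 (≤ᵇ⇒≤ 4 8 _) (≤w⇒fits (m/n≤m w v))
        blockWidth-cell : Cell (4 + t * 8) blockWidth
        blockWidth-cell = parameter-cell 4 (≤ᵇ⇒≤ 5 8 _) (fitsZ 16 (*-monoʳ-≤ 16 m≤Z))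
        base-cell : Cell (5 + t * 8) base
        base-cell = parameter-cell 5 (≤ᵇ⇒≤ 6 8 _) (fitsZ 16 (*-monoʳ-≤ 16 H≤Z))
        2^v-cell : Cell (6 + t * 8) (2 ^ v)
        2^v-cell = parameter-cell 6 (≤ᵇ⇒≤ 7 8 _) (^-monoʳ-< 2 (≤ᵇ⇒≤ 2 2 _) v<w)

        queryTrace : ∃[ ρ ] Trace w Cell queryProgram (((λ _ → 0) [ 1 ≔ b ]) [ 0 ≔ a ]) ρ × ρ 0 ≡ lo + sel lo len
        queryTrace = query-trace {w} {Cell} {a = a} {b} {H} {b ∸ a} {s} {s / H} {fromBool (s <ᵇ H)}
          {s + H} {(s + H) * fromBool (s <ᵇ H)} {t} {t * 8} {g} {S} {v} {perWord i} {blockWidth} {base} {2 ^ v}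
          {a + g} {a + γ} {a′} {b + 1} {b′} {d} {a′ * blockWidth} {idx} {q} {r} {q + q} {q + q + 1} {address i q}
          {address i q + base} {word} {r * v} {word ≫ (r * v)} {sel lo len} {lo} {lo + sel lo len}
          (fits 8 (m≤m*n 8 Z³ {{>-nonZero (≤-trans 1≤Z Z≤Z³)}})) H-cell
          (⇓sub b a a≤b (≤n⇒fits (<⇒≤ b<n))) sum⇓
          (⇓div s H (≤n⇒fits s≤n)) (⇓lt s H (≤n⇒fits 1≤n)) t₁⇓ t₂⇓ t⇓
          (⇓mul t 8 (parameter-address-fits 0 (s≤s z≤n))) parameter-address-fits
          g-cell S-cell v-cell perWord-cell blockWidth-cell base-cell 2^v-cell
          (⇓add a g a+g<M) e⇓ a′⇓ (⇓add b 1 (≤n⇒fits b+1≤n)) b′⇓ d⇓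
          i₁⇓ idx⇓ q⇓ r⇓ q₂⇓ q₃⇓ q₄⇓ z⇓ z-cell sh⇓ (⇓shr word (r * v) word<M) out⇓
          (⇓mul a′ g (≤n⇒fits lo≤n)) p⇓

      query : ∃[ lo ] ∃[ len ] 1 ≤ len × a ≤ lo × lo + len ≤ suc b × len ≤ suc (b ∸ a)
        × (suc (b ∸ a) ∸ len) * m ≤ suc (b ∸ a)
        × Computes queryProgram (length queryProgram) (storing {w} {size} addressable cell) a b (lo + sel lo len)
      query = lo , len , 1≤coreLength , ≤coreStart ,
        subst₂ _≤_ (sym core-end) (+-comm b 1) coreEnd≤ , coreLength≤ , lost-small ,
        subst (Computes queryProgram (length queryProgram) (storing {w} {size} addressable cell) a b) (proj₂ (proj₂ queryTrace))
          (computes {w} {size} addressable cell (≤n⇒fits (≤-trans a≤b (<⇒≤ b<n))) (≤n⇒fits (<⇒≤ b<n)) (proj₁ (proj₂ queryTrace)))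

    answeringStructure : ∀ d → w ≤ d * L → (∀ {lo len} → 1 ≤ len → lo + len ≤ n → sel lo len < len) →
      Σ (DataStructure w) λ D → DataStructure.bits D ≤ (144 * d + 1152) * n * (m * m)
        × (∀ {a b} → a ≤ b → b < n →
          ∃[ lo ] ∃[ len ] 1 ≤ len × a ≤ lo × lo + len ≤ suc b × len ≤ suc (b ∸ a)
            × (suc (b ∸ a) ∸ len) * m ≤ suc (b ∸ a)
            × Computes queryProgram (length queryProgram) D a b (lo + sel lo len))
    answeringStructure d w≤dL sel-< = storing {w} {size} addressable cell , bits≤ d w≤dL , query sel-<

-- From stored offsets to α-approximate selection

module _ {ℓ ℓ₁ ℓ₂} (O : TotalOrder ℓ ℓ₁ ℓ₂) {f} (F : FixedRank f) {n} (c : Vec (TotalOrder.Carrier O) n) where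

  IsRankWithin : (δ : ℕ) (a b p : Fin n) → Set (ℓ ⊔ℓ ℓ₁ ⊔ℓ ℓ₂)
  IsRankWithin δ a b p = a Fin.≤ p × p Fin.≤ b × ∃[ i ] HasRank O (range c a b) i (Vec.lookup c p)
    × f (rangeSize a b) ≤ i + δ × i ≤ f (rangeSize a b) + δ

  selectionStructure : ∀ {L m w} {{_ : NonZero m}} {{_ : NonZero w}} d →
    1 ≤ n → n < 2 ^ L → 2 ^ L ≤ 2 * n → 2 ≤ m → m ≤ 2 ^ L →
    14 * L ≤ w → w ≤ d * L →
    Σ (DataStructure w) λ D → DataStructure.bits D ≤ (144 * d + 1152) * n * (m * m)
      × ∀ (a b : Fin n) → a Fin.≤ b → ∃[ δ ] ∃[ p ] δ * m ≤ rangeSize a b × IsRankWithin δ a b p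
        × Computes queryProgram (length queryProgram) D (toℕ a) (toℕ b) (toℕ p)
  selectionStructure {L} {m} {w} d 1≤n n<2^L 2^L≤2n 2≤m m≤2^L 14L≤w w≤dL =
    let D , bits≤ , query =
          Layout.answeringStructure n L m w (select O c f)
            1≤n n<2^L 2^L≤2n 2≤m m≤2^L 14L≤w d w≤dL (select-< O c f F)
    in D , bits≤ , λ a b a≤b →
      let lo , len , 1≤len , a≤lo , hi≤b , len≤s , lost≤s , computed = query a≤b (toℕ<n b)
          p , p≡ , within = select-rank O c f F 1≤len (≤-trans hi≤b (toℕ<n b)) {a} {b} a≤b a≤lo hi≤b (m+[n∸m]≡n len≤s)
      in rangeSize a b ∸ len , p , lost≤s , within ,
         subst (Computes queryProgram (length queryProgram) D (toℕ a) (toℕ b)) (sym p≡) computed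

-- For M > n the bound forces δ = 0, so precision beyond n + 1 comes for free.
precision-capped : ∀ {n M δ s} → s ≤ n → δ * (M ⊓ suc n) ≤ s → δ * M ≤ s
precision-capped {δ = zero} _ _ = z≤n
precision-capped {n} {M} {suc δ} {s} s≤n δm≤s with ≤-total M (suc n)
... | inj₁ M≤n = subst (λ k → suc δ * k ≤ s) (m≤n⇒m⊓n≡m M≤n) δm≤s
... | inj₂ n<M = contradiction (≤-trans δm≤s s≤n)
  (<⇒≱ (subst (λ k → n < suc δ * k) (sym (m≥n⇒m⊓n≡n n<M)) (m≤m+n (suc n) (δ * suc n))))

-- A core is guaranteed to be nonempty from precision 2 on, which is why `bracket` delivers a
-- successor exponent.
2≤precision : ∀ e {n} → 1 ≤ n → 2 ≤ 2 ^ suc e ⊓ suc n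
2≤precision e 1≤n = ⊓-glb (*-monoʳ-≤ 2 (m^n>0 2 e)) (s≤s 1≤n)

module _ {ℓ ℓ₁ ℓ₂} (d : ℕ) (α : ℝ) {f} (F : FixedRank f) (O : TotalOrder ℓ ℓ₁ ℓ₂) where

  ApproximateSelection : (n : ℕ) (c : Vec (TotalOrder.Carrier O) n) (w : ℕ) → Set (ℓ ⊔ℓ ℓ₁ ⊔ℓ ℓ₂)
  ApproximateSelection n c w = Σ (DataStructure w) λ D →
    SpaceBound (16 * (144 * d + 1152)) n α (DataStructure.bits D)
    × SupportsSelection O queryProgram (length queryProgram) α f c D

  module _ (e : ℕ) (r<α : ½^ suc e <ℝ α) (α<u : α ℝ< fromℕ 4 ℚ.* ½^ suc e) where

    approximateSelection⁺ : ∀ n c w → 1 ≤ n → 14 * lg n ≤ w → w ≤ d * lg n → ApproximateSelection n c w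
    approximateSelection⁺ n c w 1≤n 14lg≤w w≤dlg =
      let m≤M = m⊓n≤m (2 ^ suc e) (suc n)
          D , bits≤ , supports = selectionStructure O F c {lg n} {2 ^ suc e ⊓ suc n}
            {{>-nonZero (<⇒≤ (2≤precision e 1≤n))}} {{>-nonZero (≤-trans (s≤s z≤n) 14lg≤w)}}
            d 1≤n (<2^1+log n) (*-monoʳ-≤ 2 (2^log≤ n 1≤n)) (2≤precision e 1≤n)
            (≤-trans (m⊓n≤n (2 ^ suc e) (suc n)) (<2^1+log n)) 14lg≤w w≤dlg
      in D , spaceBound α {suc e} α<u (144 * d + 1152) n (DataStructure.bits D)
               (≤-trans bits≤ (*-monoʳ-≤ ((144 * d + 1152) * n) (*-mono-≤ m≤M m≤M))) ,
         λ a b a≤b →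
           let δ , p , δ≤ , (a≤p , p≤b , i , rank-i , lower , upper) , computed = supports a b a≤b
               s≤n = ≤-trans (s≤s (m∸n≤m (toℕ b) (toℕ a))) (toℕ<n b)
           in p , (a≤p , p≤b , i , rank-i ,
                   approxRank α {suc e} r<α (precision-capped {M = 2 ^ suc e} {δ} s≤n δ≤) lower upper) ,
              computed

    approximateSelection : ∀ n c w → 14 * lg n ≤ w → w ≤ d * lg n → ApproximateSelection n c w
    approximateSelection zero    c w _ _ =
      record { size = 0 ; addressable = z≤n ; contents = [] } ,
      spaceBound α {suc e} α<u (144 * d + 1152) 0 0 z≤n , λ ()
    approximateSelection (suc n) c w 14lg≤w w≤dlg = approximateSelection⁺ (suc n) c w (s≤s z≤n) 14lg≤w w≤dlg

theorem13 : ∀ {ℓ ℓ₁ ℓ₂} → ∃[ d₀ ] ∀ (d₁ : ℕ) →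
    ∃[ P ] ∃[ C ] ∃[ T ]
    ∀ (α : ℝ) → 0ℚ <ℝ α → α ℝ< ½ →
    ∀ (f : ℕ → ℕ) → FixedRank f →
    ∀ (O : TotalOrder ℓ ℓ₁ ℓ₂) (n : ℕ) (c : Vec (TotalOrder.Carrier O) n) →
    ∀ (w : ℕ) → d₀ * lg n ≤ w → w ≤ d₁ * lg n →
    Σ (DataStructure w) λ D →
    SpaceBound C n α (DataStructure.bits D) × SupportsSelection O P T α f c D
-- Words of 14 lg n bits hold every address and intermediate value, by `2048Z³≤2^w`; the bracket
-- comes from `bits≤` with `d = d₁`, and its factor 16 from `spaceBound`.
theorem13 = 14 , λ d₁ → queryProgram , 16 * (144 * d₁ + 1152) , length queryProgram ,
  λ α 0<α α<½ f F O →
    let e , r<α , α<u = bracket α 0<α α<½ in approximateSelection d₁ α F O e r<α α<u
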